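{- Let $T=(V,E,w)$ be a weighted tree and let $\pi=\{x_1,\dots,x_n\}$ be a priority ordering of $V$. Then there is an isometric embedding $f:(V,d_T)\to\ell_\infty$, i.e. $\|f(u)-f(v)\|_\infty=d_T(u,v)$ for all $u,v\in V$, with prioritized dimension $O(\log j)$.
   Context: $d_T$ is the shortest-path metric of $T$. The embedding $f$ has prioritized dimension $\beta$ if, for every $j$, $f(x_j)$ is non-zero only in its first $\beta(j)$ coordinates. Here $\beta(j)=O(\log j)$ with an absolute constant independent of $T$ and $n$. -}

module Defs where

open import Level using (Level; _⊔_) renaming (suc to lsuc)
open import Algebra.Bundles using (AbelianGroup)
open import Relation.Binary.Core using (Rel)
open import Relation.Binary.Structures using (IsTotalOrder)
open import Relation.Nullary using (¬_)
open import Data.Nat as ℕ using (ℕ; zero; suc)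
open import Data.Nat.Logarithm using (⌊log₂_⌋)
open import Data.Fin using (Fin; toℕ)
open import Data.List using (List; []; _∷_)
open import Data.List.Relation.Unary.Unique.Propositional using (Unique)
open import Data.Product using (Σ; ∃; _×_; _,_)
open import Data.Sum using (_⊎_)

-- Scalars: a linearly (totally) ordered abelian group.  The real numbers
-- (R, +, ≤) are an instance; all distances/coordinates live here.

record OrderedAbelianGroup (c ℓ₁ ℓ₂ : Level) : Set (lsuc (c ⊔ ℓ₁ ⊔ ℓ₂)) where
  field
    abelianGroup : AbelianGroup c ℓ₁
  open AbelianGroup abelianGroup public
  infix 4 _≤_ _<_
  field
    _≤_          : Rel Carrier ℓ₂
    isTotalOrder : IsTotalOrder _≈_ _≤_
    ≤-compat     : ∀ {x y} z → x ≤ y → (x ∙ z) ≤ (y ∙ z)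

  _−_ : Carrier → Carrier → Carrier
  x − y = x ∙ (y ⁻¹)

  _<_ : Rel Carrier (ℓ₁ ⊔ ℓ₂)
  x < y = (x ≤ y) × ¬ (x ≈ y)

module _ {a} {n : ℕ} (Adj : Fin n → Fin n → Set a) where

  data Walk : Fin n → Fin n → Set a where
    []  : ∀ {u} → Walk u u
    _∷_ : ∀ {u v t} → Adj u v → Walk v t → Walk u t

  walkVertices : ∀ {u v} → Walk u v → List (Fin n)
  walkVertices {u} []      = u ∷ []
  walkVertices {u} (_ ∷ p) = u ∷ walkVertices p

  walkLength : ∀ {u v} → Walk u v → ℕ
  walkLength []      = zero
  walkLength (_ ∷ p) = suc (walkLength p)

  HasCycle : Set a
  HasCycle = Σ (Fin n) λ u → Σ (Fin n) λ v → Σ (Walk u v) λ p →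
               Unique (walkVertices p) × (2 ℕ.≤ walkLength p) × Adj v u

-- Weighted trees on the vertex set Fin n (vertex j is x_{j+1} of the
-- priority ordering).

record WeightedTree {c ℓ₁ ℓ₂} (G : OrderedAbelianGroup c ℓ₁ ℓ₂) (n : ℕ)
       : Set (lsuc (c ⊔ ℓ₁ ⊔ ℓ₂)) where
  open OrderedAbelianGroup G
  field
    Adj        : Fin n → Fin n → Set (c ⊔ ℓ₁ ⊔ ℓ₂)
    adj-sym    : ∀ {u v} → Adj u v → Adj v u
    adj-irrefl : ∀ {u} → ¬ Adj u u
    w          : Fin n → Fin n → Carrier
    w-sym      : ∀ {u v} → Adj u v → w u v ≈ w v u
    w-pos      : ∀ {u v} → Adj u v → ε < w u v
    connected  : ∀ u v → Walk Adj u v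
    acyclic    : ¬ HasCycle Adj

  weight : ∀ {u v} → Walk Adj u v → Carrier
  weight []               = ε
  weight (_∷_ {u} {v} _ p) = w u v ∙ weight p

  _d≈_ : Fin n → Fin n → Carrier → Set (c ⊔ ℓ₁ ⊔ ℓ₂)
  (u d≈ v) r = (Σ (Walk Adj u v) λ p → weight p ≈ r)
             × (∀ (p : Walk Adj u v) → r ≤ weight p)

module _ {c ℓ₁ ℓ₂} {G : OrderedAbelianGroup c ℓ₁ ℓ₂} {n : ℕ} where
  open OrderedAbelianGroup G

  -- ‖f u − f v‖∞ = r, unfolding sup_i |f u i − f v i| = r for vectors of
  -- finite support (so the supremum is a maximum).
  SupDist≈ : (ℕ → Carrier) → (ℕ → Carrier) → Carrier → Set (ℓ₁ ⊔ ℓ₂)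
  SupDist≈ x y r = (∀ i → ((x i − y i) ≤ r) × ((y i − x i) ≤ r))
                 × (∃ λ i → ((x i − y i) ≈ r) ⊎ ((y i − x i) ≈ r))

  IsometricEmbedding : WeightedTree G n → (Fin n → ℕ → Carrier) → Set (c ⊔ ℓ₁ ⊔ ℓ₂)
  IsometricEmbedding T f =
    ∀ u v r → WeightedTree._d≈_ T u v r → SupDist≈ (f u) (f v) r

  -- f(x_j) is non-zero only in its first β(j) coordinates
  -- (the tree argument only fixes the implicit G and n)
  HasPrioritizedDimension : WeightedTree G n → (ℕ → ℕ) → (Fin n → ℕ → Carrier) → Set ℓ₁
  HasPrioritizedDimension _ β f =
    ∀ (j : Fin n) (i : ℕ) → β (suc (toℕ j)) ℕ.≤ i → f j i ≈ ε

logBound : ℕ → ℕ → ℕ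
logBound C j = C ℕ.* suc ⌊log₂ j ⌋

{-# OPTIONS --safe #-}
module Submission where

-- Root the tree at x₁ and let ω z be the weight of the edge above z.  Then d(u, v) is the sum of ω z over
-- the z that are ancestors of exactly one of u and v, so a choice of signs of the edges gives a
-- 1-Lipschitz potential, which attains d(u, v) when the signs are constant and opposite on the two legs
-- of the path.  Repeated splitting at centroids (Linial, London, Rabinovich) gives O(log m) choices of
-- signs that realise all pairs whose path meets a given set of m edges.
--
-- Let K i be the closure under lowest common ancestors of the first 2^(2^i − 1) vertices.  Its Voronoi
-- cells are subtrees, so they are separated by at most |K i| edges.  Stage i realises the pairs that lie
-- in one cell of K i but in different cells of K (i + 1), by O(2^i) functions vanishing on K i: on the
-- cells of one colour of a proper 2-colouring of the tree of cells, normalise a potential to be 0 at the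
-- centre.  Since K i is closed, a path between two cells of equal colour meets K i, so this is
-- 1-Lipschitz together with 0 on K i, and it extends by McShane's formula.  A vertex of priority j lies
-- in K i for some i with 2^i = O(log j), hence vanishes after the first O(log j) coordinates.

open import Defs
open import Level using (Level; 0ℓ)
open import Algebra.Bundles using (AbelianGroup)
import Algebra.Properties.CommutativeMonoid.Sum
open import Data.Bool using (Bool; true; false; not; _∨_; _xor_; if_then_else_)
open import Data.Bool.Properties using (not-¬) renaming (_≟_ to _≟B_)
open import Data.Empty using (⊥-elim)
open import Data.Fin using (Fin; zero; suc; toℕ; fromℕ<; combine)
open import Data.Fin.Properties using (_≟_; any?; toℕ<n; toℕ-injective; toℕ-fromℕ<; combine-injective; injective⇒≤; suc-injective)
open import Data.List using (List; []; _∷_; _++_; map; filter; find; length; lookup; allFin; applyUpTo)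
open import Data.List.Properties using (length-++; length-map; length-applyUpTo)
open import Data.List.Membership.Propositional using (_∈_; _∉_; lose)
open import Data.List.Membership.Propositional.Properties using (∈-allFin; ∈-lookup; ∈-applyUpTo⁺; ∈-filter⁺; ∈-filter⁻; ∈-map⁺; ∈-++⁺ˡ; ∈-++⁺ʳ)
import Data.List.Membership.DecPropositional
open import Data.List.Relation.Unary.All as All using (All; []; _∷_)
import Data.List.Relation.Unary.All.Properties as All
open import Data.List.Relation.Unary.AllPairs using (AllPairs; []; _∷_)
open import Data.List.Relation.Unary.Any using (Any; here; there)
import Data.List.Relation.Unary.Any.Properties as Any
open import Data.List.Relation.Unary.Unique.Propositional using (Unique)
open import Data.List.Relation.Unary.Unique.Propositional.Properties using (allFin⁺; filter⁺)
open import Data.Maybe using (Maybe; just; nothing)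
open import Data.Maybe.Properties using (just-injective)
open import Data.Nat as ℕ using (ℕ; zero; suc; _+_; _*_; _^_; _∸_; z≤n; s≤s) renaming (_≤_ to _≤ℕ_; _<_ to _<ℕ_)
open import Data.Nat.Logarithm using (⌊log₂_⌋; ⌊log₂⌋-mono-≤; ⌊log₂[2^n]⌋≡n)
import Data.Nat.Properties as ℕ
open import Data.Nat.Solver using (module +-*-Solver)
open import Data.Product using (Σ; ∃; _×_; _,_; proj₁; proj₂)
open import Data.Sum using (_⊎_; inj₁; inj₂; [_,_]′; swap)
open import Data.Unit using (⊤; tt)
open import Function using (_∘_)
open import Relation.Binary.Bundles using (Poset)
open import Relation.Binary.Definitions using (tri<; tri≈; tri>)
open import Relation.Binary.PropositionalEquality as ≡ using (_≡_; _≢_; cong; cong₂; subst)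
import Relation.Binary.Reasoning.PartialOrder
open import Relation.Binary.Structures using (IsTotalOrder)
open import Relation.Nullary using (¬_; Dec; yes; no; does)
open import Relation.Nullary.Decidable using (_×-dec_; _⊎-dec_; ¬?; toSum; decidable-stable)
open import Relation.Unary using (Pred; Decidable; _⊆_; _∩_)
open import Relation.Unary.Properties using (_∩?_)

-- Rooted trees

record RootedTree (N : ℕ) : Set where
  field
    root         : Fin N
    parent       : Fin N → Fin N
    depth        : Fin N → ℕ
    parent-root  : parent root ≡ root
    depth-root   : depth root ≡ 0
    depth-parent : ∀ {x} → x ≢ root → depth x ≡ suc (depth (parent x))

module Ancestors {N : ℕ} (R : RootedTree N) where
  open RootedTree R public

  V : Set
  V = Fin N

  abstract
    treeInd : ∀ {ℓ} (P : V → Set ℓ) → P root →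
              (∀ x → x ≢ root → P (parent x) → P x) → ∀ x → P x
    treeInd P base step x = go (depth x) x ≡.refl
      where
      go : ∀ k x → depth x ≡ k → P x
      go k x eq with x ≟ root
      go k x eq | yes ≡.refl = base
      go zero x eq | no x≢r with ≡.trans (≡.sym eq) (depth-parent x≢r)
      ... | ()
      go (suc k) x eq | no x≢r =
        step x x≢r (go k (parent x) (ℕ.suc-injective (≡.trans (≡.sym (depth-parent x≢r)) eq)))

  module _ {a : Level} {A : Set a} (base : A) (step : V → A → A) where

    abstract
      unroll : ℕ → V → A
      unroll zero    x = base
      unroll (suc k) x = step x (unroll k (parent x))

      -- Recursion down from the root with the depth as fuel. Being abstract, it is known only
      -- through the two equations below.
      inherit : V → A
      inherit x = unroll (depth x) x

      inherit-root : inherit root ≡ base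
      inherit-root = cong (λ k → unroll k root) depth-root

      inherit-step : ∀ {x} → x ≢ root → inherit x ≡ step x (inherit (parent x))
      inherit-step {x} x≢r = cong (λ k → unroll k x) (depth-parent x≢r)

  infix 4 _⊒_ _⊒?_

  -- Reflexive ancestry: `z` is met on the climb from `x`. Derivations are not unique, because the
  -- root is its own parent.
  data _⊒_ (z : V) : V → Set where
    here : z ⊒ z
    up   : ∀ {x} → z ⊒ parent x → z ⊒ x

  ⊒-trans : ∀ {x y z} → x ⊒ y → y ⊒ z → x ⊒ z
  ⊒-trans p here   = p
  ⊒-trans p (up q) = up (⊒-trans p q)

  parent⊒ : ∀ x → parent x ⊒ x
  parent⊒ x = up here

  ⊒root⇒≡ : ∀ {z x} → z ⊒ x → x ≡ root → z ≡ root
  ⊒root⇒≡ here   eq   = eq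
  ⊒root⇒≡ (up p) ≡.refl = ⊒root⇒≡ p parent-root

  root⊒ : ∀ x → root ⊒ x
  root⊒ = treeInd (root ⊒_) here (λ _ _ → up)

  proper⇒⊒parent : ∀ {z x} → z ⊒ x → z ≢ x → z ⊒ parent x
  proper⇒⊒parent here   z≢x = ⊥-elim (z≢x ≡.refl)
  proper⇒⊒parent (up p) _   = p

  ⊒⇒depth≤ : ∀ {z x} → z ⊒ x → depth z ≤ℕ depth x
  ⊒⇒depth≤ here = ℕ.≤-refl
  ⊒⇒depth≤ (up {x} p) with x ≟ root
  ... | yes ≡.refl = subst (λ y → _ ≤ℕ depth y) parent-root (⊒⇒depth≤ p)
  ... | no x≢r   = ℕ.≤-trans (⊒⇒depth≤ p) (ℕ.≤-trans (ℕ.n≤1+n _) (ℕ.≤-reflexive (≡.sym (depth-parent x≢r))))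

  ⊒parent⇒depth< : ∀ {z x} → x ≢ root → z ⊒ parent x → depth z <ℕ depth x
  ⊒parent⇒depth< x≢r p = ℕ.≤-trans (s≤s (⊒⇒depth≤ p)) (ℕ.≤-reflexive (≡.sym (depth-parent x≢r)))

  ⋣parent : ∀ {x} → x ≢ root → ¬ x ⊒ parent x
  ⋣parent x≢r p = ℕ.<-irrefl ≡.refl (⊒parent⇒depth< x≢r p)

  ⊒-antisym : ∀ {x y} → x ⊒ y → y ⊒ x → x ≡ y
  ⊒-antisym {x} {y} p q with x ≟ y | y ≟ root
  ... | yes eq | _        = eq
  ... | no _   | yes y≡r  = ≡.trans (⊒root⇒≡ p y≡r) (≡.sym y≡r)
  ... | no x≢y | no y≢r   =
    ⊥-elim (ℕ.<-irrefl ≡.refl (ℕ.<-≤-trans (⊒parent⇒depth< y≢r (proper⇒⊒parent p x≢y)) (⊒⇒depth≤ q)))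

  -- The climb from `x` is deterministic, so of two ancestors the one met later lies above the
  -- other.
  comparable : ∀ {z w x} → z ⊒ x → w ⊒ x → z ⊒ w ⊎ w ⊒ z
  comparable here   q      = inj₂ q
  comparable (up p) here   = inj₁ (up p)
  comparable (up p) (up q) = comparable p q

  abstract
    _⊒?_ : ∀ z x → Dec (z ⊒ x)
    z ⊒? x = treeInd (λ x → Dec (z ⊒ x)) base step x
      where
      base : Dec (z ⊒ root)
      base with z ≟ root
      ... | yes ≡.refl = yes here
      ... | no z≢r   = no (λ p → z≢r (⊒root⇒≡ p ≡.refl))
      step : ∀ x → x ≢ root → Dec (z ⊒ parent x) → Dec (z ⊒ x)
      step x _ (yes p) = yes (up p)
      step x _ (no ¬p) with z ≟ x
      ... | yes ≡.refl = yes here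
      ... | no z≢x   = no (λ p → ¬p (proper⇒⊒parent p z≢x))

  abstract
    -- Climb from `x` until an ancestor of `y` is met, at the latest the root.
    lca-exists : ∀ y x → Σ V λ a → a ⊒ x × a ⊒ y × (∀ {w} → w ⊒ x → w ⊒ y → w ⊒ a)
    lca-exists y = treeInd _ (root , here , root⊒ y , λ p _ → p) step
      where
      step : ∀ x → x ≢ root →
             (Σ V λ a → a ⊒ parent x × a ⊒ y × (∀ {w} → w ⊒ parent x → w ⊒ y → w ⊒ a)) →
             Σ V λ a → a ⊒ x × a ⊒ y × (∀ {w} → w ⊒ x → w ⊒ y → w ⊒ a)
      step x _ (a , p , q , least) with x ⊒? y
      ... | yes x⊒y = x , here , x⊒y , λ r _ → r
      ... | no x⋣y  = a , up p , q , λ r s → least (proper⇒⊒parent r (λ { ≡.refl → x⋣y s })) s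

  lca : V → V → V
  lca x y = proj₁ (lca-exists y x)

  lca⊒ˡ : ∀ x y → lca x y ⊒ x
  lca⊒ˡ x y = proj₁ (proj₂ (lca-exists y x))

  lca⊒ʳ : ∀ x y → lca x y ⊒ y
  lca⊒ʳ x y = proj₁ (proj₂ (proj₂ (lca-exists y x)))

  lca-lowest : ∀ {w} x y → w ⊒ x → w ⊒ y → w ⊒ lca x y
  lca-lowest x y = proj₂ (proj₂ (proj₂ (lca-exists y x)))

  lca-unique : ∀ {a x y} → a ⊒ x → a ⊒ y → (∀ {w} → w ⊒ x → w ⊒ y → w ⊒ a) → lca x y ≡ a
  lca-unique {a} {x} {y} p q least =
    ⊒-antisym (least (lca⊒ˡ x y) (lca⊒ʳ x y)) (lca-lowest x y p q)

  -- If neither inner lca is above the other, they head disjoint subtrees. A common ancestor of `a`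
  -- and `c` is then above both: otherwise one inner lca would be an ancestor of a vertex below the
  -- other, making the two comparable. Hence lcas of pairs from any set are already closed under
  -- lca.
  lca-lca : ∀ a b c e → let m = lca (lca a b) (lca c e) in
            m ≡ lca a b ⊎ m ≡ lca c e ⊎ m ≡ lca a c
  lca-lca a b c e with lca a b ⊒? lca c e | lca c e ⊒? lca a b
  ... | yes p | _     = inj₁ (lca-unique here p (λ r _ → r))
  ... | no _  | yes p = inj₂ (inj₁ (lca-unique p here (λ _ r → r)))
  ... | no m₁⋣m₂ | no m₂⋣m₁ = inj₂ (inj₂ (≡.sym (lca-unique
          (⊒-trans (lca⊒ˡ m₁ m₂) (lca⊒ˡ a b)) (⊒-trans (lca⊒ʳ m₁ m₂) (lca⊒ˡ c e)) least)))
    where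
    m₁ = lca a b
    m₂ = lca c e
    least : ∀ {w} → w ⊒ a → w ⊒ c → w ⊒ lca m₁ m₂
    least {w} w⊒a w⊒c = lca-lowest m₁ m₂ w⊒m₁ w⊒m₂
      where
      w⊒m₁ : w ⊒ m₁
      w⊒m₁ with comparable w⊒a (lca⊒ˡ a b)
      ... | inj₁ p = p
      ... | inj₂ m₁⊒w with comparable (⊒-trans m₁⊒w w⊒c) (lca⊒ˡ c e)
      ...   | inj₁ p = ⊥-elim (m₁⋣m₂ p)
      ...   | inj₂ p = ⊥-elim (m₂⋣m₁ p)
      w⊒m₂ : w ⊒ m₂
      w⊒m₂ with comparable w⊒c (lca⊒ˡ c e)
      ... | inj₁ p = p
      ... | inj₂ m₂⊒w with comparable (⊒-trans m₂⊒w w⊒a) (lca⊒ˡ a b)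
      ...   | inj₁ p = ⊥-elim (m₂⋣m₁ p)
      ...   | inj₂ p = ⊥-elim (m₁⋣m₂ p)

-- Counting

module _ {a p : Level} {A : Set a} where

  count : {P : Pred A p} → Decidable P → List A → ℕ
  count P? xs = length (filter P? xs)

  count-empty⊎∃ : {P : Pred A p} (P? : Decidable P) → ∀ xs → count P? xs ≡ 0 ⊎ ∃ P
  count-empty⊎∃ P? [] = inj₁ ≡.refl
  count-empty⊎∃ P? (x ∷ xs) with P? x
  ... | yes px = inj₂ (x , px)
  ... | no _   = count-empty⊎∃ P? xs

  count-∈ : {P : Pred A p} (P? : Decidable P) → ∀ {x xs} → x ∈ xs → P x → 1 ≤ℕ count P? xs
  count-∈ P? {x} {y ∷ xs} x∈ px with P? y
  count-∈ P? {x} {y ∷ xs} x∈         px | yes _ = s≤s z≤n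
  count-∈ P? {x} {y ∷ xs} (here ≡.refl) px | no ¬p = ⊥-elim (¬p px)
  count-∈ P? {x} {y ∷ xs} (there x∈)  px | no _  = count-∈ P? x∈ px

module _ {a p q r : Level} {A : Set a} {P : Pred A p} {Q : Pred A q} {R : Pred A r}
         (P? : Decidable P) (Q? : Decidable Q) (R? : Decidable R) where

  count-disjoint : P ⊆ R → Q ⊆ R → (∀ {x} → P x → ¬ Q x) →
                   ∀ xs → count P? xs + count Q? xs ≤ℕ count R? xs
  count-disjoint P⊆R Q⊆R disj [] = z≤n
  count-disjoint P⊆R Q⊆R disj (x ∷ xs) with P? x | Q? x | R? x | count-disjoint P⊆R Q⊆R disj xs
  ... | yes px | yes qx | _      | _  = ⊥-elim (disj px qx)
  ... | yes px | no _   | no ¬rx | _  = ⊥-elim (¬rx (P⊆R px))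
  ... | yes px | no _   | yes _  | ih = s≤s ih
  ... | no _   | yes qx | no ¬rx | _  = ⊥-elim (¬rx (Q⊆R qx))
  ... | no _   | yes qx | yes _  | ih = ℕ.≤-trans (ℕ.≤-reflexive (ℕ.+-suc _ _)) (s≤s ih)
  ... | no _   | no _   | yes _  | ih = ℕ.≤-trans ih (ℕ.n≤1+n _)
  ... | no _   | no _   | no _   | ih = ih

module _ {a p q : Level} {A : Set a} {P : Pred A p} {Q : Pred A q}
         (P? : Decidable P) (Q? : Decidable Q) where

  count-mono : P ⊆ Q → ∀ xs → count P? xs ≤ℕ count Q? xs
  count-mono P⊆Q [] = z≤n
  count-mono P⊆Q (x ∷ xs) with P? x | Q? x | count-mono P⊆Q xs
  ... | yes px | no ¬qx | _  = ⊥-elim (¬qx (P⊆Q px))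
  ... | yes _  | yes _  | ih = s≤s ih
  ... | no _   | yes _  | ih = ℕ.≤-trans ih (ℕ.n≤1+n _)
  ... | no _   | no _   | ih = ih

argmax : ∀ {a p} {A : Set a} {P : Pred A p} → Decidable P → (h : A → ℕ) → ∃ P → ∀ xs →
         Σ A λ q → P q × (∀ {x} → x ∈ xs → P x → h x ≤ℕ h q)
argmax P? h (x₀ , p₀) [] = x₀ , p₀ , λ ()
argmax P? h w (y ∷ ys) with argmax P? h w ys | P? y
... | q , pq , ub | no ¬py = q , pq , λ { (here ≡.refl) py → ⊥-elim (¬py py) ; (there x∈) → ub x∈ }
... | q , pq , ub | yes py with h y ℕ.≤? h q
...   | yes y≤q = q , pq , λ { (here ≡.refl) _ → y≤q ; (there x∈) → ub x∈ }
...   | no y≰q  = y , py , λ { (here ≡.refl) _ → ℕ.≤-refl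
                             ; (there x∈) px → ℕ.≤-trans (ub x∈ px) (ℕ.<⇒≤ (ℕ.≰⇒> y≰q)) }

-- A discrete intermediate value argument. It locates the branch of a vertex at which a running
-- total passes one half, and the stage at which no such branch exists is the second alternative.
last-true : ∀ {p} {P : Pred ℕ p} → Decidable P → P 0 → ∀ n →
            (Σ ℕ λ t → P t × ¬ P (suc t)) ⊎ P n
last-true P? p₀ zero = inj₂ p₀
last-true P? p₀ (suc n) with last-true P? p₀ n | P? (suc n)
... | inj₁ w | _      = inj₁ w
... | inj₂ p | yes p′ = inj₂ p′
... | inj₂ p | no ¬p′ = inj₁ (n , p , ¬p′)

complement-of-majority : ∀ a b {m} → a + b ≤ℕ m → m <ℕ 2 * b → 2 * a ≤ℕ m
complement-of-majority a b {m} a+b≤m m<2b = ℕ.+-cancelˡ-≤ m _ _ (begin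
  m + 2 * a       ≤⟨ ℕ.+-monoˡ-≤ (2 * a) (ℕ.<⇒≤ m<2b) ⟩
  2 * b + 2 * a   ≡⟨ ℕ.+-comm (2 * b) (2 * a) ⟩
  2 * a + 2 * b   ≡⟨ ℕ.*-distribˡ-+ 2 a b ⟨
  2 * (a + b)     ≤⟨ ℕ.*-monoʳ-≤ 2 a+b≤m ⟩
  2 * m           ≡⟨ cong (m +_) (ℕ.+-identityʳ m) ⟩
  m + m           ∎)
  where open ℕ.≤-Reasoning

-- Sign patterns separating a set of edges

module Separation {N : ℕ} (R : RootedTree N) where
  open Ancestors R

  -- x stands for the edge joining x to its parent.
  OnPath : V → V → V → Set
  OnPath u v x = (x ⊒ u × ¬ x ⊒ v) ⊎ (x ⊒ v × ¬ x ⊒ u)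

  -- Signs record increments away from the root, so the corresponding potential rises all the way
  -- from `u` up to the lca and down to `v`.
  Opposite : (V → Bool) → V → V → Set
  Opposite σ u v = (∀ {x} → x ⊒ u → ¬ x ⊒ v → σ x ≡ false)
                 × (∀ {x} → x ⊒ v → ¬ x ⊒ u → σ x ≡ true)

  Realises : (V → Bool) → V → V → Set
  Realises σ u v = Opposite σ u v ⊎ Opposite σ v u

  -- Splitting the tree at a vertex

  data Part : Set where
    above centre left middle right : Part

  _≟ₚ_ : (a b : Part) → Dec (a ≡ b)
  above  ≟ₚ above  = yes ≡.refl
  above  ≟ₚ centre = no λ ()
  above  ≟ₚ left   = no λ ()
  above  ≟ₚ middle = no λ ()
  above  ≟ₚ right  = no λ ()
  centre ≟ₚ above  = no λ ()
  centre ≟ₚ centre = yes ≡.refl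
  centre ≟ₚ left   = no λ ()
  centre ≟ₚ middle = no λ ()
  centre ≟ₚ right  = no λ ()
  left   ≟ₚ above  = no λ ()
  left   ≟ₚ centre = no λ ()
  left   ≟ₚ left   = yes ≡.refl
  left   ≟ₚ middle = no λ ()
  left   ≟ₚ right  = no λ ()
  middle ≟ₚ above  = no λ ()
  middle ≟ₚ centre = no λ ()
  middle ≟ₚ left   = no λ ()
  middle ≟ₚ middle = yes ≡.refl
  middle ≟ₚ right  = no λ ()
  right  ≟ₚ above  = no λ ()
  right  ≟ₚ centre = no λ ()
  right  ≟ₚ left   = no λ ()
  right  ≟ₚ middle = no λ ()
  right  ≟ₚ right  = yes ≡.refl

  -- Four parts get different pairs of bits; centre may share those of right, as q is an ancestor of it.
  code₁ code₂ : Part → Bool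
  code₁ above  = false
  code₁ centre = true
  code₁ left   = false
  code₁ middle = true
  code₁ right  = true
  code₂ above  = false
  code₂ centre = true
  code₂ left   = true
  code₂ middle = false
  code₂ right  = true

  module Branch (q : V) where

    Below : V → Set
    Below x = q ⊒ x × x ≢ q

    below? : Decidable Below
    below? x = (q ⊒? x) ×-dec ¬? (x ≟ q)

    below≢root : ∀ {x} → Below x → x ≢ root
    below≢root (q⊒x , x≢q) x≡r = x≢q (≡.trans x≡r (≡.sym (⊒root⇒≡ q⊒x x≡r)))

    Below-⊒ : ∀ {x y} → Below x → x ⊒ y → Below y
    Below-⊒ (q⊒x , x≢q) x⊒y = ⊒-trans q⊒x x⊒y , λ { ≡.refl → x≢q (⊒-antisym x⊒y q⊒x) }

    -- The child of q above x; junk unless x lies strictly below q.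
    branch : V → V
    branch = inherit root (λ x a → if does (parent x ≟ q) then x else a)

    branch-child : ∀ {x} → x ≢ root → parent x ≡ q → branch x ≡ x
    branch-child {x} x≢r eq rewrite inherit-step root (λ x a → if does (parent x ≟ q) then x else a) x≢r
      with parent x ≟ q
    ... | yes _  = ≡.refl
    ... | no neq = ⊥-elim (neq eq)

    branch-parent : ∀ {x} → x ≢ root → parent x ≢ q → branch x ≡ branch (parent x)
    branch-parent {x} x≢r neq rewrite inherit-step root (λ x a → if does (parent x ≟ q) then x else a) x≢r
      with parent x ≟ q
    ... | yes eq = ⊥-elim (neq eq)
    ... | no _   = ≡.refl

    branch-inherited : ∀ {x y} → Below x → x ⊒ y → branch y ≡ branch x
    branch-inherited b here = ≡.refl
    branch-inherited b@(q⊒x , x≢q) (up {y} x⊒py) = ≡.trans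
      (branch-parent (below≢root (Below-⊒ b (up x⊒py)))
        (λ py≡q → x≢q (⊒-antisym (subst (_ ⊒_) py≡q x⊒py) q⊒x)))
      (branch-inherited b x⊒py)

    branch-spec : ∀ x → Below x → branch x ≢ root × parent (branch x) ≡ q × branch x ⊒ x
    branch-spec = treeInd _ (λ b → ⊥-elim (below≢root b ≡.refl)) step
      where
      step : ∀ x → x ≢ root →
             (Below (parent x) → branch (parent x) ≢ root × parent (branch (parent x)) ≡ q × branch (parent x) ⊒ parent x) →
             Below x → branch x ≢ root × parent (branch x) ≡ q × branch x ⊒ x
      step x x≢r ih (q⊒x , x≢q) with parent x ≟ q
      ... | yes eq rewrite branch-child x≢r eq = x≢r , eq , here
      ... | no neq rewrite branch-parent x≢r neq
          with ih (proper⇒⊒parent q⊒x (λ e → x≢q (≡.sym e)) , neq)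
      ...   | c≢r , eq , p = c≢r , eq , up p

  module Split (q : V) (t : ℕ) where
    open Branch q public

    -- The children of `q` are ordered by their index. The threshold `t` groups the branches below
    -- `q` into those before child `t`, that of child `t` alone, and those after it.
    classify : V → Part
    classify c with ℕ.<-cmp (toℕ c) t
    ... | tri< _ _ _ = left
    ... | tri≈ _ _ _ = middle
    ... | tri> _ _ _ = right

    part : V → Part
    part x with q ⊒? x | x ≟ q
    ... | no _  | _     = above
    ... | yes _ | yes _ = centre
    ... | yes _ | no _  = classify (branch x)

    part-above : ∀ {x} → ¬ q ⊒ x → part x ≡ above
    part-above {x} ¬p with q ⊒? x | x ≟ q
    ... | no _  | _ = ≡.refl
    ... | yes p | _ = ⊥-elim (¬p p)

    part-below : ∀ {x} → Below x → part x ≡ classify (branch x)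
    part-below {x} (p , x≢q) with q ⊒? x | x ≟ q
    ... | no ¬p | _       = ⊥-elim (¬p p)
    ... | yes _ | yes x≡q = ⊥-elim (x≢q x≡q)
    ... | yes _ | no _    = ≡.refl

    part-inherited : ∀ {x y} → Below x → x ⊒ y → part x ≡ part y
    part-inherited b x⊒y = ≡.trans (part-below b)
      (≡.trans (cong classify (≡.sym (branch-inherited b x⊒y))) (≡.sym (part-below (Below-⊒ b x⊒y))))

    classify≢above : ∀ c → classify c ≢ above
    classify≢above c with ℕ.<-cmp (toℕ c) t
    ... | tri< _ _ _ = λ ()
    ... | tri≈ _ _ _ = λ ()
    ... | tri> _ _ _ = λ ()

    classify≢centre : ∀ c → classify c ≢ centre
    classify≢centre c with ℕ.<-cmp (toℕ c) t
    ... | tri< _ _ _ = λ ()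
    ... | tri≈ _ _ _ = λ ()
    ... | tri> _ _ _ = λ ()

    part≡above : ∀ {x} → part x ≡ above → ¬ q ⊒ x
    part≡above {x} eq with q ⊒? x | x ≟ q
    part≡above {x} ()  | yes _ | yes _
    ... | no ¬p | _    = ¬p
    ... | yes _ | no _ = ⊥-elim (classify≢above (branch x) eq)

    part≡centre : ∀ {x} → part x ≡ centre → x ≡ q
    part≡centre {x} eq with q ⊒? x | x ≟ q
    part≡centre {x} ()  | no _ | _
    ... | yes _ | yes e = e
    ... | yes _ | no _  = ⊥-elim (classify≢centre (branch x) eq)

    part-Below : ∀ {x} → part x ≢ above → part x ≢ centre → Below x
    part-Below {x} ≢a ≢c with q ⊒? x | x ≟ q
    ... | no _  | _      = ⊥-elim (≢a ≡.refl)
    ... | yes _ | yes _  = ⊥-elim (≢c ≡.refl)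
    ... | yes p | no x≢q = p , x≢q

    classify-left : ∀ {c} → classify c ≡ left → toℕ c <ℕ t
    classify-left {c} eq with ℕ.<-cmp (toℕ c) t
    ... | tri< p _ _ = p
    classify-left {c} () | tri≈ _ _ _
    classify-left {c} () | tri> _ _ _

    classify-middle : ∀ {c} → classify c ≡ middle → toℕ c ≡ t
    classify-middle {c} eq with ℕ.<-cmp (toℕ c) t
    ... | tri≈ _ p _ = p
    classify-middle {c} () | tri< _ _ _
    classify-middle {c} () | tri> _ _ _

    classify-right : ∀ {c} → classify c ≡ right → t <ℕ toℕ c
    classify-right {c} eq with ℕ.<-cmp (toℕ c) t
    ... | tri> _ _ p = p
    classify-right {c} () | tri< _ _ _
    classify-right {c} () | tri≈ _ _ _

    -- The signs of the increments, away from the root, of x ↦ ±d(x, q), where ± is s (part x).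
    signed : (Part → Bool) → V → Bool
    signed s x = does (x ⊒? q) ∨ s (part x)

    signed-above : ∀ s {x} → x ⊒ q → signed s x ≡ true
    signed-above s {x} p with x ⊒? q
    ... | yes _ = ≡.refl
    ... | no ¬p = ⊥-elim (¬p p)

    signed-other : ∀ s {x} → ¬ x ⊒ q → signed s x ≡ s (part x)
    signed-other s {x} ¬p with x ⊒? q
    ... | yes p = ⊥-elim (¬p p)
    ... | no _  = ≡.refl

    -- Since `above` is negative, `v` lies at or below `q`, and the path from `u` to `v` passes
    -- through `q`: the potential climbs from -d(u, q) to 0 and on to d(q, v).
    signed-opposite : ∀ s → s above ≡ false → ∀ {u v} →
                      s (part u) ≡ false → s (part v) ≡ true → Opposite (signed s) u v
    signed-opposite s s-above {u} {v} su sv = fromᵘ , fromᵛ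
      where
      conflict : true ≡ false → ∀ {ℓ} {A : Set ℓ} → A
      conflict ()

      q⊒v : q ⊒ v
      q⊒v = decidable-stable (q ⊒? v) λ ¬p → conflict (≡.trans (≡.sym sv) (≡.trans (cong s (part-above ¬p)) s-above))

      fromᵘ : ∀ {x} → x ⊒ u → ¬ x ⊒ v → signed s x ≡ false
      fromᵘ {x} x⊒u x⋣v = ≡.trans (signed-other s x⋣q) lem
        where
        x⋣q : ¬ x ⊒ q
        x⋣q p = x⋣v (⊒-trans p q⊒v)
        lem : s (part x) ≡ false
        lem with toSum (q ⊒? x)
        ... | inj₂ q⋣x = ≡.trans (cong s (part-above q⋣x)) s-above
        ... | inj₁ q⊒x = ≡.trans (cong s (part-inherited (q⊒x , λ { ≡.refl → x⋣q here }) x⊒u)) su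

      fromᵛ : ∀ {x} → x ⊒ v → ¬ x ⊒ u → signed s x ≡ true
      fromᵛ {x} x⊒v _ with toSum (x ⊒? q)
      ... | inj₁ x⊒q = signed-above s x⊒q
      ... | inj₂ x⋣q with comparable q⊒v x⊒v
      ...   | inj₁ q⊒x = ≡.trans (signed-other s x⋣q) (≡.trans (cong s (part-inherited (q⊒x , λ { ≡.refl → x⋣q here }) x⊒v)) sv)
      ...   | inj₂ p   = ⊥-elim (x⋣q p)

    signed-realises : ∀ s → s above ≡ false → ∀ {u v} →
                      s (part u) ≢ s (part v) → Realises (signed s) u v
    signed-realises s s-above {u} {v} neq with s (part u) in eu | s (part v) in ev
    ... | false | true  = inj₁ (signed-opposite s s-above eu ev)
    ... | true  | false = inj₂ (signed-opposite s s-above ev eu)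
    ... | false | false = ⊥-elim (neq ≡.refl)
    ... | true  | true  = ⊥-elim (neq ≡.refl)

    centre⊒right : ∀ {x y} → part x ≡ centre → part y ≡ right → x ⊒ y
    centre⊒right px py = subst (_⊒ _) (≡.sym (part≡centre px))
      (proj₁ (part-Below (subst (_≢ above) (≡.sym py) λ ()) (subst (_≢ centre) (≡.sym py) λ ())))

    -- The codes tell all parts apart except `centre` from `right`; but `centre` is only `q`, which
    -- is comparable to itself and to everything in `right`.
    same-code : ∀ {u v} → ¬ u ⊒ v → ¬ v ⊒ u →
                code₁ (part u) ≡ code₁ (part v) → code₂ (part u) ≡ code₂ (part v) →
                part u ≡ part v × part u ≢ centre
    same-code {u} {v} u⋣v v⋣u e₁ e₂ with part u in pu | part v in pv
    same-code u⋣v v⋣u e₁ e₂ | above  | above  = ≡.refl , λ ()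
    same-code u⋣v v⋣u e₁ () | above  | left
    same-code u⋣v v⋣u () e₂ | above  | middle
    same-code u⋣v v⋣u () e₂ | above  | right
    same-code u⋣v v⋣u () e₂ | above  | centre
    same-code u⋣v v⋣u e₁ () | left   | above
    same-code u⋣v v⋣u e₁ e₂ | left   | left   = ≡.refl , λ ()
    same-code u⋣v v⋣u () e₂ | left   | middle
    same-code u⋣v v⋣u () e₂ | left   | right
    same-code u⋣v v⋣u () e₂ | left   | centre
    same-code u⋣v v⋣u () e₂ | middle | above
    same-code u⋣v v⋣u () e₂ | middle | left
    same-code u⋣v v⋣u e₁ e₂ | middle | middle = ≡.refl , λ ()
    same-code u⋣v v⋣u e₁ () | middle | right
    same-code u⋣v v⋣u e₁ () | middle | centre
    same-code u⋣v v⋣u () e₂ | right  | above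
    same-code u⋣v v⋣u () e₂ | right  | left
    same-code u⋣v v⋣u e₁ () | right  | middle
    same-code u⋣v v⋣u e₁ e₂ | right  | right  = ≡.refl , λ ()
    same-code u⋣v v⋣u e₁ e₂ | right  | centre = ⊥-elim (v⋣u (centre⊒right pv pu))
    same-code u⋣v v⋣u () e₂ | centre | above
    same-code u⋣v v⋣u () e₂ | centre | left
    same-code u⋣v v⋣u e₁ () | centre | middle
    same-code u⋣v v⋣u e₁ e₂ | centre | right  = ⊥-elim (u⋣v (centre⊒right pu pv))
    same-code {u} u⋣v v⋣u e₁ e₂ | centre | centre =
      ⊥-elim (u⋣v (subst (u ⊒_) (≡.trans (part≡centre pu) (≡.sym (part≡centre pv))) here))

    -- An edge is named by its lower end. So even when the path passes through `q`, each of its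
    -- edges lies strictly below `q`, in the branch of `u` or of `v`. For `above`, ancestors of a
    -- vertex outside the subtree of `q` are outside too.
    part-constant : ∀ {u v x} → part u ≡ part v → part u ≢ centre → OnPath u v x → part x ≡ part u
    part-constant {u} {v} {x} pu≡pv ≢c on with part u ≟ₚ above
    part-constant {u} {v} {x} pu≡pv ≢c (inj₁ (x⊒u , _)) | yes e =
      ≡.trans (part-above (λ p → part≡above e (⊒-trans p x⊒u))) (≡.sym e)
    part-constant {u} {v} {x} pu≡pv ≢c (inj₂ (x⊒v , _)) | yes e =
      ≡.trans (part-above (λ p → part≡above (≡.trans (≡.sym pu≡pv) e) (⊒-trans p x⊒v))) (≡.sym e)
    part-constant {u} {v} {x} pu≡pv ≢c on | no ≢a = lem on
      where
      bu = part-Below ≢a ≢c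
      bv = part-Below (λ e → ≢a (≡.trans pu≡pv e)) (λ e → ≢c (≡.trans pu≡pv e))
      strictly : ∀ {y z} → x ⊒ y → ¬ x ⊒ z → q ⊒ y → q ⊒ z → Below x
      strictly x⊒y x⋣z q⊒y q⊒z with comparable q⊒y x⊒y
      ... | inj₁ q⊒x = q⊒x , λ { ≡.refl → x⋣z q⊒z }
      ... | inj₂ x⊒q = ⊥-elim (x⋣z (⊒-trans x⊒q q⊒z))
      lem : OnPath u v x → part x ≡ part u
      lem (inj₁ (x⊒u , x⋣v)) = part-inherited (strictly x⊒u x⋣v (proj₁ bu) (proj₁ bv)) x⊒u
      lem (inj₂ (x⊒v , x⋣u)) = ≡.trans (part-inherited (strictly x⊒v x⋣u (proj₁ bv) (proj₁ bu)) x⊒v) (≡.sym pu≡pv)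

  vertices : List V
  vertices = allFin N

  -- Centroids and recursive halving

  module _ {E : Pred V 0ℓ} (E? : Decidable E) where

    -- `centre` is exempt: it is the single edge above `q`, and the recursion does not enter it.
    HalvingSplit : ∀ {S : Pred V 0ℓ} → Decidable S → V → ℕ → Set
    HalvingSplit S? q t = ∀ c → c ≢ centre →
      2 * count ((S? ∩? λ x → Split.part q t x ≟ₚ c) ∩? E?) vertices ≤ℕ count (S? ∩? E?) vertices

    module Halving {S : Pred V 0ℓ} (S? : Decidable S) where

      W? : Decidable (S ∩ E)
      W? = S? ∩? E?

      m : ℕ
      m = count W? vertices

      under : V → ℕ
      under z = count (W? ∩? (z ⊒?_)) vertices

      Heavy : V → Set
      Heavy z = m <ℕ 2 * under z

      -- All targets lie under the root, and a positive total exceeds half of itself.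
      root-heavy : ∃ (S ∩ E) → Heavy root
      root-heavy (x , w) = ℕ.<-≤-trans
        (ℕ.+-monoˡ-≤ m (count-∈ W? (∈-allFin x) w))
        (ℕ.≤-trans (ℕ.≤-reflexive (cong (m +_) (≡.sym (ℕ.+-identityʳ m)))) (ℕ.*-monoʳ-≤ 2
          (count-mono W? (W? ∩? (root ⊒?_)) (λ {x} w → w , root⊒ x) vertices)))

      module _ (q : V) where
        open Branch q

        Prefix : ℕ → V → Set
        Prefix k x = Below x × toℕ (branch x) <ℕ k

        prefix? : ∀ k → Decidable (Prefix k)
        prefix? k x = below? x ×-dec (toℕ (branch x) ℕ.<? k)

        size : ℕ → ℕ
        size k = count (W? ∩? prefix? k) vertices

        Light : ℕ → Set
        Light k = 2 * size k ≤ℕ m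

        light-0 : Light 0
        light-0 with count-empty⊎∃ (W? ∩? prefix? 0) vertices
        ... | inj₁ eq = subst (λ k → 2 * k ≤ℕ m) (≡.sym eq) z≤n
        ... | inj₂ (_ , _ , _ , ())

        -- The threshold comes just before the prefix of branches turns into a majority. If that
        -- never happens, `t` = `N` is past every child.
        cut : Σ ℕ λ t → Light t × (m <ℕ 2 * size (suc t) ⊎ N ≤ℕ t)
        cut with last-true (λ k → 2 * size k ℕ.≤? m) light-0 N
        ... | inj₁ (t , p , ¬p) = t , p , inj₁ (ℕ.≰⇒> ¬p)
        ... | inj₂ p            = N , p , inj₂ ℕ.≤-refl

      module _ (q : V) (heavy : Heavy q) (deepest : ∀ {x} → x ∈ vertices → Heavy x → depth x ≤ℕ depth q)
               (t : ℕ) (light : Light q t) (cut-off : m <ℕ 2 * size q (suc t) ⊎ N ≤ℕ t) where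
        open Split q t

        cell? : ∀ c → Decidable ((S ∩ (λ x → part x ≡ c)) ∩ E)
        cell? c = (S? ∩? λ x → part x ≟ₚ c) ∩? E?

        below-of : ∀ {c x} → c ≢ above → c ≢ centre → part x ≡ c → Below x × classify (branch x) ≡ c
        below-of ≢a ≢c e = b , ≡.trans (≡.sym (part-below b)) e
          where b = part-Below (λ e′ → ≢a (≡.trans (≡.sym e) e′)) (λ e′ → ≢c (≡.trans (≡.sym e) e′))

        -- The complement consists of what is under the heavy vertex `q`.
        halves-above : 2 * count (cell? above) vertices ≤ℕ m
        halves-above = complement-of-majority (count (cell? above) vertices) (under q)
          (count-disjoint (cell? above) (W? ∩? (q ⊒?_)) W? (λ { ((s , _) , e) → s , e }) proj₁
            (λ { ((_ , pa) , _) (_ , q⊒x) → part≡above pa q⊒x }) vertices)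
          heavy

        halves-left : 2 * count (cell? left) vertices ≤ℕ m
        halves-left = ℕ.≤-trans (ℕ.*-monoʳ-≤ 2 (count-mono (cell? left) (W? ∩? prefix? q t) sub vertices)) light
          where
          sub : ∀ {y} → ((S y × part y ≡ left) × E y) → ((S y × E y) × Prefix q t y)
          sub ((s , pl) , e) with below-of (λ ()) (λ ()) pl
          ... | b , cl = (s , e) , b , classify-left cl

        -- The complement contains the prefix up to and including child `t`, a majority. In the
        -- other case every index is below `N`, and `right` is empty.
        halves-right : m <ℕ 2 * size q (suc t) ⊎ N ≤ℕ t → 2 * count (cell? right) vertices ≤ℕ m
        halves-right (inj₁ majority) = complement-of-majority (count (cell? right) vertices) (size q (suc t))
          (count-disjoint (cell? right) (W? ∩? prefix? q (suc t)) W?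
            (λ { ((s , _) , e) → s , e }) proj₁
            (λ { ((_ , pr) , _) (_ , _ , s≤s b≤t) →
                 ℕ.<⇒≱ (classify-right (proj₂ (below-of (λ ()) (λ ()) pr))) b≤t })
            vertices) majority
        halves-right (inj₂ N≤t) with count-empty⊎∃ (cell? right) vertices
        ... | inj₁ eq = subst (λ k → 2 * k ≤ℕ m) (≡.sym eq) z≤n
        ... | inj₂ (x , (_ , pr) , _) =
          ⊥-elim (ℕ.<⇒≱ (ℕ.≤-<-trans N≤t (classify-right (proj₂ (below-of (λ ()) (λ ()) pr)))) (ℕ.<⇒≤ (toℕ<n _)))

        -- This part is the subtree of one child of `q`; were it to hold a majority, the child would
        -- be a heavy vertex deeper than `q`.
        halves-middle : 2 * count (cell? middle) vertices ≤ℕ m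
        halves-middle with count-empty⊎∃ (cell? middle) vertices
        ... | inj₁ eq = subst (λ k → 2 * k ≤ℕ m) (≡.sym eq) z≤n
        ... | inj₂ (x , (_ , pm) , _) with below-of (λ ()) (λ ()) pm
        ...   | b , cl with branch-spec x b
        ...     | c≢r , pc≡q , _ =
          ℕ.≤-trans (ℕ.*-monoʳ-≤ 2 (count-mono (cell? middle) (W? ∩? (branch x ⊒?_)) sub vertices))
                  (ℕ.≮⇒≥ (λ h → ℕ.<⇒≱ deeper (deepest (∈-allFin (branch x)) h)))
          where
          deeper : depth q <ℕ depth (branch x)
          deeper = ⊒parent⇒depth< c≢r (subst (q ⊒_) (≡.sym pc≡q) here)
          sub : ∀ {y} → ((S y × part y ≡ middle) × E y) → ((S y × E y) × branch x ⊒ y)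
          sub {y} ((s , pm′) , e) with below-of (λ ()) (λ ()) pm′
          ... | b′ , cl′ = (s , e) , subst (_⊒ y)
                (toℕ-injective (≡.trans (classify-middle cl′) (≡.sym (classify-middle cl)))) (proj₂ (proj₂ (branch-spec y b′)))

        halves : HalvingSplit S? q t
        halves above  _  = halves-above
        halves centre ≢c = ⊥-elim (≢c ≡.refl)
        halves left   _  = halves-left
        halves middle _  = halves-middle
        halves right  _  = halves-right cut-off

      abstract
        -- The centroid `q` is a deepest heavy vertex.
        halvingSplit : ∃ (S ∩ E) → Σ V λ q → Σ ℕ (HalvingSplit S? q)
        halvingSplit w with argmax (λ z → m ℕ.<? 2 * under z) depth (root , root-heavy w) vertices
        ... | q , heavy , deepest with cut q
        ...   | t , light , cut-off = q , t , halves q heavy deepest t light cut-off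

    Incomparable : V → V → Set
    Incomparable u v = ¬ u ⊒ v × ¬ v ⊒ u

    -- Two patterns are spent on each of `B` rounds of halving; only indices below `2 * B` count.
    -- Comparable pairs are left to a separate constant pattern.
    record SignFamily (S : Pred V 0ℓ) (B : ℕ) : Set where
      field
        sign     : ℕ → V → Bool
        realises : ∀ {u v} → Incomparable u v → (∀ {x} → OnPath u v x → S x) →
                   ∃ (λ x → OnPath u v x × E x) → Σ ℕ λ b → b <ℕ 2 * B × Realises (sign b) u v

    open SignFamily

    transfer : ∀ {σ τ : V → Bool} {u v} → (∀ {x} → OnPath u v x → σ x ≡ τ x) →
               Realises σ u v → Realises τ u v
    transfer eq (inj₁ (f , g)) = inj₁
      ( (λ p ¬p → ≡.trans (≡.sym (eq (inj₁ (p , ¬p)))) (f p ¬p))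
      , (λ p ¬p → ≡.trans (≡.sym (eq (inj₂ (p , ¬p)))) (g p ¬p)) )
    transfer eq (inj₂ (f , g)) = inj₂
      ( (λ p ¬p → ≡.trans (≡.sym (eq (inj₂ (p , ¬p)))) (f p ¬p))
      , (λ p ¬p → ≡.trans (≡.sym (eq (inj₁ (p , ¬p)))) (g p ¬p)) )

    module Combine {S : Pred V 0ℓ} {B : ℕ} (q : V) (t : ℕ)
                   (piece : ∀ c → c ≢ centre → SignFamily (S ∩ (λ x → Split.part q t x ≡ c)) B) where
      open Split q t

      pieceSign : ∀ c → Dec (c ≡ centre) → ℕ → V → Bool
      -- A default: no path handled by a piece contains an edge of `centre`.
      pieceSign c (yes _) b = λ _ → true
      pieceSign c (no ≢c) b = sign (piece c ≢c) b

      -- The first two patterns treat pairs in different parts. The parts are disjoint, so the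
      -- families of all the pieces are glued and share the remaining indices.
      sign′ : ℕ → V → Bool
      sign′ zero            = signed code₁
      sign′ (suc zero)      = signed code₂
      sign′ (suc (suc b)) x = pieceSign (part x) (part x ≟ₚ centre) b x

      pieceSign-≢ : ∀ {c c′} (≢c : c ≢ centre) (d : Dec (c′ ≡ centre)) → c′ ≡ c → ∀ {b y} →
                    sign (piece c ≢c) b y ≡ pieceSign c′ d b y
      pieceSign-≢ ≢c (yes e) ≡.refl = ⊥-elim (≢c e)
      -- Two proofs of a negation are definitionally equal, so `p` and `≢c` select the same piece.
      pieceSign-≢ ≢c (no p)  ≡.refl = ≡.refl

      realises′ : ∀ {u v} → Incomparable u v → (∀ {x} → OnPath u v x → S x) →
                  ∃ (λ x → OnPath u v x × E x) → Σ ℕ λ b → b <ℕ 2 * suc B × Realises (sign′ b) u v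
      realises′ {u} {v} (u⋣v , v⋣u) inS hit
        with code₁ (part u) ≟B code₁ (part v) | code₂ (part u) ≟B code₂ (part v)
      ... | no neq | _      = 0 , s≤s z≤n , signed-realises code₁ ≡.refl neq
      ... | yes _  | no neq = 1 , subst (1 <ℕ_) (≡.sym (ℕ.*-suc 2 B)) (s≤s (s≤s z≤n)) , signed-realises code₂ ≡.refl neq
      ... | yes e₁ | yes e₂ with same-code u⋣v v⋣u e₁ e₂
      ...   | pu≡pv , ≢c with realises (piece (part u) ≢c) (u⋣v , v⋣u) (λ o → inS o , part-constant pu≡pv ≢c o) hit
      ...     | b , b< , r = suc (suc b) , subst (suc (suc b) <ℕ_) (≡.sym (ℕ.*-suc 2 B)) (s≤s (s≤s b<)) ,
                transfer (λ {y} o → pieceSign-≢ ≢c (part y ≟ₚ centre) (part-constant pu≡pv ≢c o)) r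

      combined : SignFamily S (suc B)
      combined = record { sign = sign′ ; realises = realises′ }

    noTargets : ∀ {B S} (S? : Decidable S) → count (S? ∩? E?) vertices ≡ 0 → SignFamily S B
    noTargets S? none = record
      { sign     = λ _ _ → true
      ; realises = λ { _ inS (x , on , e) → ⊥-elim (ℕ.<⇒≱ {0} ℕ.≤-refl
          (ℕ.≤-trans (count-∈ (S? ∩? E?) (∈-allFin x) (inS on , e)) (ℕ.≤-reflexive none))) }
      }

    -- Each round at least halves the number of targets in a piece, so after `B` rounds none is left
    -- and the claim is vacuous.
    signFamily : ∀ B {S} (S? : Decidable S) → count (S? ∩? E?) vertices <ℕ 2 ^ B → SignFamily S B
    signFamily zero    S? few = noTargets S? (ℕ.n<1⇒n≡0 few)
    signFamily (suc B) {S} S? few = [ noTargets S? , split ]′ (count-empty⊎∃ (S? ∩? E?) vertices)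
      where
      split : ∃ (S ∩ E) → SignFamily S (suc B)
      split w = Combine.combined q t piece
        where
        q = proj₁ (Halving.halvingSplit S? w)
        t = proj₁ (proj₂ (Halving.halvingSplit S? w))
        part? : ∀ c → Decidable (S ∩ (λ x → Split.part q t x ≡ c))
        part? c = S? ∩? λ x → Split.part q t x ≟ₚ c
        piece : ∀ c → c ≢ centre → SignFamily (S ∩ (λ x → Split.part q t x ≡ c)) B
        piece c ≢c = signFamily B (part? c) (ℕ.*-cancelˡ-< 2 (count (part? c ∩? E?) vertices) (2 ^ B)
          (ℕ.≤-<-trans (proj₂ (proj₂ (Halving.halvingSplit S? w)) c ≢c) few))

    -- The extra pattern, constantly `true`, serves comparable pairs: one leg of their path is
    -- empty.
    separatingSigns : ∀ B → count E? vertices <ℕ 2 ^ B →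
      Σ (List (V → Bool)) λ σs → length σs ≡ suc (2 * B) ×
        (∀ {u v} → ∃ (λ x → OnPath u v x × E x) → Σ (V → Bool) λ σ → σ ∈ σs × Realises σ u v)
    separatingSigns B few = (λ _ → true) ∷ applyUpTo (sign F) (2 * B) , cong suc (length-applyUpTo (sign F) (2 * B)) , works
      where
      F : SignFamily (λ _ → ⊤) B
      F = signFamily B (λ _ → yes tt)
        (ℕ.≤-<-trans (count-mono ((λ _ → yes tt) ∩? E?) E? proj₂ vertices) few)

      works : ∀ {u v} → ∃ (λ x → OnPath u v x × E x) →
              Σ (V → Bool) λ σ → σ ∈ (λ _ → true) ∷ applyUpTo (sign F) (2 * B) × Realises σ u v
      works {u} {v} hit with u ⊒? v | v ⊒? u
      ... | yes u⊒v | _       = _ , here ≡.refl , inj₁ ((λ p ¬p → ⊥-elim (¬p (⊒-trans p u⊒v))) , λ _ _ → ≡.refl)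
      ... | no _    | yes v⊒u = _ , here ≡.refl , inj₂ ((λ p ¬p → ⊥-elim (¬p (⊒-trans p v⊒u))) , λ _ _ → ≡.refl)
      ... | no u⋣v  | no v⋣u  with realises F (u⋣v , v⋣u) (λ _ → tt) hit
      ...   | b , b< , r = _ , there (∈-applyUpTo⁺ (sign F) b<) , r

-- Lists

fresh : ∀ {a} {A : Set a} {x : A} {xs} → Unique (x ∷ xs) → x ∉ xs
fresh (x≢ ∷ _) = All.All¬⇒¬Any x≢

lookup-unique : ∀ {a} {A : Set a} {xs : List A} → Unique xs → ∀ i j → lookup xs i ≡ lookup xs j → i ≡ j
lookup-unique (x∉ ∷ u) zero    zero    eq = ≡.refl
lookup-unique (x∉ ∷ u) zero    (suc j) eq = ⊥-elim (All.lookup x∉ (∈-lookup j) eq)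
lookup-unique (x∉ ∷ u) (suc i) zero    eq = ⊥-elim (All.lookup x∉ (∈-lookup i) (≡.sym eq))
lookup-unique (x∉ ∷ u) (suc i) (suc j) eq = cong suc (lookup-unique u i j eq)

-- The label `f` may use the proof of `P x`, so injectivity is asked across all proofs.
count-injective : ∀ {a p} {A : Set a} {P : Pred A p} (P? : Decidable P) {M} (f : ∀ {x} → P x → Fin M) →
                  (∀ {x y} (p : P x) (q : P y) → f p ≡ f q → x ≡ y) →
                  ∀ {xs} → Unique xs → count P? xs ≤ℕ M
count-injective {P = P} P? {M} f f-inj {xs} u = injective⇒≤ {f = g} λ {i} {j} eq →
  lookup-unique (filter⁺ P? u) i j (f-inj (holds i) (holds j) eq)
  where
  holds : ∀ i → P (lookup (filter P? xs) i)
  holds i = All.lookup (All.all-filter P? xs) (∈-lookup i)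
  g : Fin (length (filter P? xs)) → Fin M
  g i = f (holds i)

module _ {a p : Level} {A : Set a} {P : Pred A p} (P? : Decidable P) where

  find-just : ∀ xs {k} → find P? xs ≡ just k → P k
  find-just (x ∷ xs) eq with P? x
  find-just (x ∷ xs) ≡.refl | yes px = px
  find-just (x ∷ xs) eq     | no _   = find-just xs eq

  find-nothing : ∀ {xs x} → find P? xs ≡ nothing → x ∈ xs → ¬ P x
  find-nothing {y ∷ xs} eq x∈ px with P? y
  find-nothing {y ∷ xs} () x∈         px | yes _
  find-nothing {y ∷ xs} eq (here ≡.refl) px | no ¬p = ¬p px
  find-nothing {y ∷ xs} eq (there x∈)  px | no _  = find-nothing eq x∈ px

  find-first : ∀ {r} {_≼_ : A → A → Set r} {xs} → AllPairs _≼_ xs → ∀ {k x} →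
               find P? xs ≡ just k → x ∈ xs → P x → x ≡ k ⊎ k ≼ x
  find-first {xs = y ∷ ys} (y≼ ∷ s) eq x∈ px with P? y
  find-first {xs = y ∷ ys} (y≼ ∷ s) ≡.refl (here e)      px | yes _ = inj₁ e
  find-first {xs = y ∷ ys} (y≼ ∷ s) ≡.refl (there x∈)    px | yes _ = inj₂ (All.lookup y≼ x∈)
  find-first {xs = y ∷ ys} (y≼ ∷ s) eq     (here ≡.refl) px | no ¬p = ⊥-elim (¬p px)
  find-first {xs = y ∷ ys} (y≼ ∷ s) eq     (there x∈)    px | no _  = find-first s eq x∈ px

-- Discarding candidates other than the first hit does not change the hit. This keeps the chosen
-- centre stable on the way down to it.
find-⊆ : ∀ {a p q} {A : Set a} {P : Pred A p} {Q : Pred A q} (P? : Decidable P) (Q? : Decidable Q) →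
         Q ⊆ P → ∀ xs {k} → find P? xs ≡ just k → Q k → find Q? xs ≡ just k
find-⊆ P? Q? Q⊆P (x ∷ xs) eq qk with P? x | Q? x
find-⊆ P? Q? Q⊆P (x ∷ xs) ≡.refl qk | yes _ | yes _ = ≡.refl
find-⊆ P? Q? Q⊆P (x ∷ xs) ≡.refl qk | yes _ | no ¬q = ⊥-elim (¬q qk)
find-⊆ P? Q? Q⊆P (x ∷ xs) eq     qk | no ¬p | yes q = ⊥-elim (¬p (Q⊆P q))
find-⊆ P? Q? Q⊆P (x ∷ xs) eq     qk | no _  | no _  = find-⊆ P? Q? Q⊆P xs eq qk

module InsertionSort {a r : Level} {A : Set a} {_≼_ : A → A → Set r} (≼-trans : ∀ {x y z} → x ≼ y → y ≼ z → x ≼ z)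
                     (≼-total : ∀ x y → x ≼ y ⊎ y ≼ x) where

  insert : A → List A → List A
  insert x []       = x ∷ []
  insert x (y ∷ ys) with ≼-total x y
  ... | inj₁ _ = x ∷ y ∷ ys
  ... | inj₂ _ = y ∷ insert x ys

  sort : List A → List A
  sort []       = []
  sort (x ∷ xs) = insert x (sort xs)

  insert-here : ∀ x ys → x ∈ insert x ys
  insert-here x []       = here ≡.refl
  insert-here x (y ∷ ys) with ≼-total x y
  ... | inj₁ _ = here ≡.refl
  ... | inj₂ _ = there (insert-here x ys)

  insert-there : ∀ x {ys z} → z ∈ ys → z ∈ insert x ys
  insert-there x {y ∷ ys} z∈ with ≼-total x y
  insert-there x {y ∷ ys} z∈       | inj₁ _ = there z∈
  insert-there x {y ∷ ys} (here e) | inj₂ _ = here e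
  insert-there x {y ∷ ys} (there z∈) | inj₂ _ = there (insert-there x z∈)

  sort-∈ : ∀ {xs z} → z ∈ xs → z ∈ sort xs
  sort-∈ {x ∷ xs} (here ≡.refl) = insert-here x (sort xs)
  sort-∈ {x ∷ xs} (there z∈)  = insert-there x (sort-∈ z∈)

  insert-All : ∀ {p} {P : Pred A p} x {ys} → P x → All P ys → All P (insert x ys)
  insert-All x px [] = px ∷ []
  insert-All x {y ∷ ys} px (py ∷ pys) with ≼-total x y
  ... | inj₁ _ = px ∷ py ∷ pys
  ... | inj₂ _ = py ∷ insert-All x px pys

  insert-sorted : ∀ x {ys} → AllPairs _≼_ ys → AllPairs _≼_ (insert x ys)
  insert-sorted x [] = [] ∷ []
  insert-sorted x {y ∷ ys} (y≼ ∷ s) with ≼-total x y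
  ... | inj₁ x≼y = (x≼y ∷ All.map (≼-trans x≼y) y≼) ∷ y≼ ∷ s
  ... | inj₂ y≼x = insert-All x y≼x y≼ ∷ insert-sorted x s

  sort-sorted : ∀ xs → AllPairs _≼_ (sort xs)
  sort-sorted []       = []
  sort-sorted (x ∷ xs) = insert-sorted x (sort-sorted xs)

-- Ordered abelian groups

module OrderedGroup {c ℓ₁ ℓ₂ : Level} (G : OrderedAbelianGroup c ℓ₁ ℓ₂) where
  open OrderedAbelianGroup G public
  open IsTotalOrder isTotalOrder public
    using (total; antisym; isPartialOrder)
    renaming (refl to ≤-refl; trans to ≤-trans; reflexive to ≤-reflexive)
  open Algebra.Properties.CommutativeMonoid.Sum (AbelianGroup.commutativeMonoid abelianGroup) public
    using (sum; sum-cong-≋; ∑-distrib-+)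

  poset : Poset c ℓ₁ ℓ₂
  poset = record { isPartialOrder = isPartialOrder }

  module ≤-Reasoning = Relation.Binary.Reasoning.PartialOrder poset

  ∙-mono-≤ : ∀ {x y u v} → x ≤ y → u ≤ v → x ∙ u ≤ y ∙ v
  ∙-mono-≤ {x} {y} {u} {v} p q = ≤-trans (≤-compat u p)
    (≤-trans (≤-reflexive (comm y u)) (≤-trans (≤-compat y q) (≤-reflexive (comm v y))))

  ∙-monoʳ-≤ : ∀ x {u v} → u ≤ v → x ∙ u ≤ x ∙ v
  ∙-monoʳ-≤ x = ∙-mono-≤ ≤-refl

  [y∙z]−y≈z : ∀ y z → (y ∙ z) − y ≈ z
  [y∙z]−y≈z y z = trans (∙-congʳ (comm y z)) (trans (assoc z y (y ⁻¹)) (trans (∙-congˡ (inverseʳ y)) (identityʳ z)))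

  [x∙z]−y≈[x−y]∙z : ∀ x y z → (x ∙ z) − y ≈ (x − y) ∙ z
  [x∙z]−y≈[x−y]∙z x y z = trans (assoc x z (y ⁻¹)) (trans (∙-congˡ (comm z (y ⁻¹))) (sym (assoc x (y ⁻¹) z)))

  ≤∙⇒−≤ : ∀ {x y z} → x ≤ y ∙ z → x − y ≤ z
  ≤∙⇒−≤ {x} {y} {z} p = ≤-trans (≤-compat (y ⁻¹) p) (≤-reflexive ([y∙z]−y≈z y z))

  ≈∙⇒−≈ : ∀ {x y z} → x ≈ y ∙ z → x − y ≈ z
  ≈∙⇒−≈ {x} {y} {z} p = trans (∙-congʳ p) ([y∙z]−y≈z y z)

  ∙-cancelˡ-≤ : ∀ x {y z} → x ∙ y ≤ x ∙ z → y ≤ z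
  ∙-cancelˡ-≤ x {y} {z} p = ≤-trans (≤-reflexive (sym ([y∙z]−y≈z x y))) (≤∙⇒−≤ p)

  x≤x∙y : ∀ {x y} → ε ≤ y → x ≤ x ∙ y
  x≤x∙y {x} p = ≤-trans (≤-reflexive (sym (identityʳ x))) (∙-monoʳ-≤ x p)

  y≤x∙y : ∀ {x y} → ε ≤ x → y ≤ x ∙ y
  y≤x∙y {x} {y} p = ≤-trans (x≤x∙y p) (≤-reflexive (comm y x))

  x⁻¹≤ε : ∀ {x} → ε ≤ x → x ⁻¹ ≤ ε
  x⁻¹≤ε {x} p = ≤-trans (y≤x∙y p) (≤-reflexive (inverseʳ x))

  sum-mono : ∀ {n} {f g : Fin n → Carrier} → (∀ i → f i ≤ g i) → sum f ≤ sum g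
  sum-mono {zero}  p = ≤-refl
  sum-mono {suc n} p = ∙-mono-≤ (p zero) (sum-mono (p ∘ suc))

  sum-≤-∙ : ∀ {n} {f g h : Fin n → Carrier} → (∀ i → f i ≤ g i ∙ h i) → sum f ≤ sum g ∙ sum h
  sum-≤-∙ {f = f} {g} {h} p = ≤-trans (sum-mono p) (≤-reflexive (∑-distrib-+ g h))

  sum-≈-∙ : ∀ {n} {f g h : Fin n → Carrier} → (∀ i → f i ≈ g i ∙ h i) → sum f ≈ sum g ∙ sum h
  sum-≈-∙ {f = f} {g} {h} p = trans (sum-cong-≋ p) (∑-distrib-+ g h)

  sum-ε : ∀ {n} {f : Fin n → Carrier} → (∀ i → f i ≈ ε) → sum f ≈ ε
  sum-ε {zero}  p = refl
  sum-ε {suc n} p = trans (∙-cong (p zero) (sum-ε (p ∘ suc))) (identityˡ ε)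

  sum-single : ∀ {n} {f : Fin n → Carrier} j → (∀ {i} → i ≢ j → f i ≈ ε) → sum f ≈ f j
  sum-single {suc n} {f} zero    p =
    trans (∙-congˡ (sum-ε {f = f ∘ suc} (λ i → p {suc i} (λ ())))) (identityʳ _)
  sum-single {suc n} {f} (suc j) p =
    trans (∙-cong (p {zero} (λ ())) (sum-single {f = f ∘ suc} j (λ i≢j → p (i≢j ∘ suc-injective)))) (identityˡ _)

-- Exponents and logarithms

open +-*-Solver using (solve; _:+_; _:*_; _:=_; con)

-- expo i = 2 ^ i − 1.
expo : ℕ → ℕ
expo zero    = 0
expo (suc i) = suc (2 * expo i)

expo-step : ∀ i → expo i ≤ℕ expo (suc i)
expo-step i = ℕ.≤-trans (ℕ.m≤m+n (expo i) (expo i + 0)) (ℕ.n≤1+n _)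

expo-mono : ∀ i l → expo i ≤ℕ expo (i + l)
expo-mono i zero    = ℕ.≤-reflexive (cong expo (≡.sym (ℕ.+-identityʳ i)))
expo-mono i (suc l) = ℕ.≤-trans (expo-mono i l) (ℕ.≤-trans (expo-step (i + l)) (ℕ.≤-reflexive (cong expo (≡.sym (ℕ.+-suc i l)))))

i≤expo : ∀ i → i ≤ℕ expo i
i≤expo zero    = z≤n
i≤expo (suc i) = s≤s (ℕ.≤-trans (i≤expo i) (ℕ.m≤m+n (expo i) (expo i + 0)))

-- `expo (suc i)` is `2 * expo i + 1`, so the first value to reach `suc l` is at most twice that
-- large.
expo-between : ∀ l → Σ ℕ λ i → suc l ≤ℕ expo i × expo i ≤ℕ 2 * suc l
expo-between zero = 1 , s≤s z≤n , s≤s z≤n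
expo-between (suc l) with expo-between l
... | i , lo , hi with ℕ.m≤n⇒m<n∨m≡n lo
...   | inj₁ lt = i , lt , ℕ.≤-trans hi (ℕ.*-monoʳ-≤ 2 (ℕ.n≤1+n (suc l)))
...   | inj₂ eq = suc i , s≤s (ℕ.≤-trans lo (ℕ.m≤m+n (expo i) (expo i + 0)))
                , ℕ.≤-trans (ℕ.≤-reflexive (cong (λ k → suc (2 * k)) (≡.sym eq)))
                    (ℕ.≤-trans (ℕ.n≤1+n _) (ℕ.≤-reflexive (≡.sym (ℕ.*-suc 2 (suc l)))))

n<2^n : ∀ n → n <ℕ 2 ^ n
n<2^n zero    = s≤s z≤n
n<2^n (suc n) = ℕ.≤-<-trans (n<2^n n) (ℕ.m<m+n (2 ^ n) (ℕ.≤-trans (ℕ.m^n>0 2 n) (ℕ.m≤m+n (2 ^ n) 0)))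

n<2^[1+log₂n] : ∀ n → n <ℕ 2 ^ suc ⌊log₂ n ⌋
n<2^[1+log₂n] n = ℕ.≰⇒> λ le → ℕ.<-irrefl ≡.refl
  (ℕ.≤-trans (ℕ.≤-reflexive (≡.sym (⌊log₂[2^n]⌋≡n (suc ⌊log₂ n ⌋)))) (⌊log₂⌋-mono-≤ le))

-- The metric of a weighted rooted tree

module TreeMetric {c ℓ₁ ℓ₂ : Level} (G : OrderedAbelianGroup c ℓ₁ ℓ₂) {N : ℕ} (R : RootedTree N)
                  (ω : Fin N → OrderedAbelianGroup.Carrier G)
                  (ω-nonneg : ∀ x → OrderedAbelianGroup._≤_ G (OrderedAbelianGroup.ε G) (ω x))
                  (ω-pos : ∀ {x} → x ≢ RootedTree.root R →
                           ¬ (OrderedAbelianGroup._≤_ G (ω x) (OrderedAbelianGroup.ε G))) where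
  open OrderedGroup G
  open Ancestors R
  open Separation R

  [_]_ : Bool → Carrier → Carrier
  [ b ] x = if b then x else ε

  infix 8 [_]_

  [_]±_ : Bool → Bool → Carrier → Carrier
  ([ b ]± s) x = [ b ] (if s then x else x ⁻¹)

  -- In terms of ancestor sets, A(x) ∩ A(y) ⊆ A(k) ⊆ A(x) ∪ A(y). This says that `k` is on the path
  -- from `x` to `y`, in the form that makes distances add up edge by edge.
  record Between (x y k : V) : Set where
    field
      covers : ∀ {w} → w ⊒ x → w ⊒ y → w ⊒ k
      within : ∀ {w} → w ⊒ k → w ⊒ x ⊎ w ⊒ y

  private
    χ : V → V → Bool
    χ z x = does (z ⊒? x)

  abstract
    -- The weight of the symmetric difference of the ancestor sets. The root belongs to both and
    -- contributes nothing.
    d : V → V → Carrier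
    d u v = sum (λ z → [ χ z u xor χ z v ] ω z)

    -- Crossing the edge above `z` away from the root adds `ω z` or its inverse, as `σ z` says. The
    -- term of the root is common to all vertices.
    potential : (V → Bool) → V → Carrier
    potential σ x = sum (λ z → ([ χ z x ]± σ z) (ω z))

    potential-lipschitz : ∀ σ u v → potential σ u ≤ potential σ v ∙ d u v
    potential-lipschitz σ u v = sum-≤-∙ (λ z → term (χ z u) (χ z v) (σ z) (ω-nonneg z))
      where
      term : ∀ a b s {x} → ε ≤ x → ([ a ]± s) x ≤ ([ b ]± s) x ∙ [ a xor b ] x
      term true  true  s     p = ≤-reflexive (sym (identityʳ _))
      term false false s     p = ≤-reflexive (sym (identityʳ _))
      term true  false true  p = ≤-reflexive (sym (identityˡ _))
      term true  false false p = ≤-trans (x⁻¹≤ε p) (≤-trans p (≤-reflexive (sym (identityˡ _))))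
      term false true  true  p = ≤-trans p (x≤x∙y p)
      term false true  false p = ≤-reflexive (sym (inverseˡ _))

    potential-opposite : ∀ {σ u v} → Opposite σ u v → potential σ v ≈ potential σ u ∙ d u v
    potential-opposite {σ} {u} {v} (f , g) = sum-≈-∙ term
      where
      term : ∀ z → ([ χ z v ]± σ z) (ω z) ≈ ([ χ z u ]± σ z) (ω z) ∙ [ χ z u xor χ z v ] ω z
      term z with z ⊒? u | z ⊒? v
      ... | yes _ | yes _ = sym (identityʳ _)
      ... | no _  | no _  = sym (identityʳ _)
      ... | yes p | no q rewrite f p q = sym (inverseˡ _)
      ... | no q  | yes p rewrite g p q = sym (identityˡ _)

    d-refl : ∀ x → d x x ≈ ε
    d-refl x = sum-ε (λ z → term (χ z x))
      where
      term : ∀ a {y} → [ a xor a ] y ≈ ε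
      term true  = refl
      term false = refl

    d-sym : ∀ x y → d x y ≈ d y x
    d-sym x y = sum-cong-≋ (λ z → term (χ z x) (χ z y))
      where
      term : ∀ a b {w} → [ a xor b ] w ≈ [ b xor a ] w
      term true  true  = refl
      term true  false = refl
      term false true  = refl
      term false false = refl

    d-nonneg : ∀ x y → ε ≤ d x y
    d-nonneg x y = ≤-trans (≤-reflexive (sym (d-refl x))) (sum-mono (λ z → term (χ z x) (χ z y) (ω-nonneg z)))
      where
      term : ∀ a b {w} → ε ≤ w → [ a xor a ] w ≤ [ a xor b ] w
      term true  true  p = ≤-refl
      term true  false p = p
      term false true  p = p
      term false false p = ≤-refl

    d-triangle : ∀ x y z → d x z ≤ d x y ∙ d y z
    d-triangle x y z = sum-≤-∙ (λ w → term (χ w x) (χ w y) (χ w z) (ω-nonneg w))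
      where
      term : ∀ a b c {w} → ε ≤ w → [ a xor c ] w ≤ [ a xor b ] w ∙ [ b xor c ] w
      term true  true  true  p = ≤-reflexive (sym (identityʳ _))
      term true  true  false p = ≤-reflexive (sym (identityˡ _))
      term true  false true  p = ≤-trans p (x≤x∙y p)
      term true  false false p = ≤-reflexive (sym (identityʳ _))
      term false true  true  p = ≤-reflexive (sym (identityʳ _))
      term false true  false p = ≤-trans p (x≤x∙y p)
      term false false true  p = ≤-reflexive (sym (identityˡ _))
      term false false false p = ≤-reflexive (sym (identityʳ _))

    d-between : ∀ {x y k} → Between x y k → d x y ≈ d x k ∙ d k y
    d-between {x} {y} {k} b = sum-≈-∙ term
      where
      term : ∀ z → [ χ z x xor χ z y ] ω z ≈ [ χ z x xor χ z k ] ω z ∙ [ χ z k xor χ z y ] ω z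
      term z with z ⊒? x | z ⊒? y | z ⊒? k
      ... | yes p | yes q | no r  = ⊥-elim (r (Between.covers b p q))
      ... | yes _ | yes _ | yes _ = sym (identityʳ _)
      ... | yes _ | no _  | yes _ = sym (identityˡ _)
      ... | yes _ | no _  | no _  = sym (identityʳ _)
      ... | no _  | yes _ | yes _ = sym (identityʳ _)
      ... | no _  | yes _ | no _  = sym (identityˡ _)
      ... | no _  | no _  | no _  = sym (identityʳ _)
      ... | no p  | no q  | yes r with Between.within b r
      ...   | inj₁ p′ = ⊥-elim (p p′)
      ...   | inj₂ q′ = ⊥-elim (q q′)

    -- `u` and its parent have the same ancestors apart from `u` itself, whose term `δ` splits off.
    d-step : ∀ {u v} → u ≢ root → ¬ u ⊒ v → d u v ≈ ω u ∙ d (parent u) v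
    d-step {u} {v} u≢r u⋣v = trans (sum-≈-∙ term) (∙-congʳ (trans (sum-single u off) on))
      where
      δ : V → Carrier
      δ z = [ does (z ≟ u) ] ω z
      off : ∀ {z} → z ≢ u → δ z ≈ ε
      off {z} z≢u with z ≟ u
      ... | yes e = ⊥-elim (z≢u e)
      ... | no _  = refl
      on : δ u ≈ ω u
      on with u ≟ u
      ... | yes _ = refl
      ... | no ne = ⊥-elim (ne ≡.refl)
      term : ∀ z → [ χ z u xor χ z v ] ω z ≈ δ z ∙ [ χ z (parent u) xor χ z v ] ω z
      term z with z ≟ u | z ⊒? u | z ⊒? parent u
      ... | yes ≡.refl | no q  | _     = ⊥-elim (q here)
      ... | yes ≡.refl | yes _ | yes q = ⊥-elim (⋣parent u≢r q)
      ... | no ne      | yes p | no q  = ⊥-elim (q (proper⇒⊒parent p ne))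
      ... | no _       | no p  | yes q = ⊥-elim (p (up q))
      ... | no _       | yes _ | yes _ = sym (identityˡ _)
      ... | no _       | no _  | no _  = sym (identityˡ _)
      ... | yes ≡.refl | yes _ | no _  with u ⊒? v
      ...   | yes q = ⊥-elim (u⋣v q)
      ...   | no _  = sym (identityʳ _)

  -- If `x` were not an ancestor of `y`, the path would start with the edge above `x`, of positive
  -- weight; and symmetrically.
  d-definite : ∀ {x y} → d x y ≤ ε → x ≡ y
  d-definite {x} {y} p = ⊒-antisym (half p) (half (≤-trans (≤-reflexive (d-sym y x)) p))
    where
    half : ∀ {x y} → d x y ≤ ε → x ⊒ y
    half {x} {y} p with x ⊒? y
    ... | yes q = q
    ... | no x⋣y = ⊥-elim (ω-pos x≢r (≤-trans (x≤x∙y (d-nonneg (parent x) y)) (≤-trans (≤-reflexive (sym (d-step x≢r x⋣y))) p)))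
      where
      x≢r : x ≢ root
      x≢r ≡.refl = x⋣y (root⊒ y)

  _≼_ : V → V → Set ℓ₂
  x ≼ y = d root x ≤ d root y

  open InsertionSort {_≼_ = _≼_} ≤-trans (λ x y → total (d root x) (d root y)) using (sort; sort-∈; sort-sorted)

  byHeight : List V
  byHeight = sort (allFin N)

  ancestor-between : ∀ {x y} → x ⊒ y → Between root y x
  ancestor-between {x} {y} x⊒y = record
    { covers = λ w⊒r _ → subst (_⊒ x) (≡.sym (⊒root⇒≡ w⊒r ≡.refl)) (root⊒ x)
    ; within = λ w⊒x → inj₂ (⊒-trans w⊒x x⊒y) }

  -- For vertices below `x`, the distance to `x` and the height differ by the constant `d root x`.
  ≼⇒d≤ : ∀ {x k k′} → x ⊒ k → x ⊒ k′ → k ≼ k′ → d x k ≤ d x k′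
  ≼⇒d≤ {x} p p′ k≼k′ = ∙-cancelˡ-≤ (d root x)
    (≤-trans (≤-reflexive (sym (d-between (ancestor-between p))))
    (≤-trans k≼k′ (≤-reflexive (d-between (ancestor-between p′)))))

  -- Voronoi cells of an lca-closed set

  module Voronoi (K : Pred V 0ℓ) (K? : Decidable K) (K-root : K root)
                 (K-lca : ∀ {a b} → K a → K b → K (lca a b)) where

    Under : V → V → Set
    Under x k = K k × x ⊒ k

    under? : ∀ x → Decidable (Under x)
    under? x k = K? k ×-dec (x ⊒? k)

    -- Searching a list sorted once and for all breaks ties consistently along root-to-leaf paths;
    -- equality in G need not be decidable.
    near : V → Maybe V
    near x = find (under? x) byHeight

    choose : V → Maybe V → V → V
    choose x nothing  k₀ = k₀
    choose x (just k) k₀ with total (d x k) (d x k₀)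
    ... | inj₁ _ = k
    ... | inj₂ _ = k₀

    choose-either : ∀ x m k₀ → choose x m k₀ ≡ k₀ ⊎ m ≡ just (choose x m k₀)
    choose-either x nothing  k₀ = inj₁ ≡.refl
    choose-either x (just k) k₀ with total (d x k) (d x k₀)
    ... | inj₁ _ = inj₂ ≡.refl
    ... | inj₂ _ = inj₁ ≡.refl

    choose-≤-old : ∀ x m k₀ → d x (choose x m k₀) ≤ d x k₀
    choose-≤-old x nothing  k₀ = ≤-refl
    choose-≤-old x (just k) k₀ with total (d x k) (d x k₀)
    ... | inj₁ p = p
    ... | inj₂ _ = ≤-refl

    choose-≤-new : ∀ x k k₀ → d x (choose x (just k) k₀) ≤ d x k
    choose-≤-new x k k₀ with total (d x k) (d x k₀)
    ... | inj₁ _ = ≤-refl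
    ... | inj₂ p = p

    abstract
      -- The centre of the cell of `x`: the better of the nearest centre in the subtree of `x` and
      -- the centre of its parent.
      κ : V → V
      κ = inherit root (λ x k₀ → choose x (near x) k₀)

      κ-root : κ root ≡ root
      κ-root = inherit-root root (λ x k₀ → choose x (near x) k₀)

      κ-step : ∀ {x} → x ≢ root → κ x ≡ choose x (near x) (κ (parent x))
      κ-step = inherit-step root (λ x k₀ → choose x (near x) k₀)

    κ-∈ : ∀ x → K (κ x)
    κ-∈ = treeInd _ (subst K (≡.sym κ-root) K-root) step
      where
      step : ∀ x → x ≢ root → K (κ (parent x)) → K (κ x)
      step x x≢r ih with choose-either x (near x) (κ (parent x))
      ... | inj₁ e = subst K (≡.sym (≡.trans (κ-step x≢r) e)) ih
      ... | inj₂ e = subst K (≡.sym (κ-step x≢r)) (proj₁ (find-just (under? x) byHeight e))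

    -- A centre outside the subtree of `x` is reached through the parent, where induction applies;
    -- inside the subtree `near` is optimal.
    κ-nearest : ∀ x {k} → K k → d x (κ x) ≤ d x k
    κ-nearest = treeInd _ (λ {k} _ → subst (λ y → d root y ≤ d root k) (≡.sym κ-root)
                             (≤-trans (≤-reflexive (d-refl root)) (d-nonneg root k))) step
      where
      step : ∀ x → x ≢ root → (∀ {k} → K k → d (parent x) (κ (parent x)) ≤ d (parent x) k) →
             ∀ {k} → K k → d x (κ x) ≤ d x k
      step x x≢r ih {k} Kk rewrite κ-step x≢r with x ⊒? k
      ... | no x⋣k = begin
        d x (choose x (near x) (κ (parent x)))       ≤⟨ choose-≤-old x (near x) (κ (parent x)) ⟩
        d x (κ (parent x))                           ≤⟨ d-triangle x (parent x) (κ (parent x)) ⟩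
        d x (parent x) ∙ d (parent x) (κ (parent x)) ≤⟨ ∙-monoʳ-≤ _ (ih Kk) ⟩
        d x (parent x) ∙ d (parent x) k              ≈⟨ ∙-congʳ (trans (d-step x≢r (⋣parent x≢r)) (trans (∙-congˡ (d-refl _)) (identityʳ _))) ⟩
        ω x ∙ d (parent x) k                         ≈⟨ d-step x≢r x⋣k ⟨
        d x k                                        ∎
        where open ≤-Reasoning
      ... | yes x⊒k with near x in eq
      ...   | nothing = ⊥-elim (find-nothing (under? x) eq (sort-∈ (∈-allFin k)) (Kk , x⊒k))
      ...   | just k₁ = ≤-trans (choose-≤-new x k₁ (κ (parent x))) k₁≤k
        where
        k₁≤k : d x k₁ ≤ d x k
        k₁≤k with find-first (under? x) (sort-sorted (allFin N)) eq (sort-∈ (∈-allFin k)) (Kk , x⊒k)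
        ... | inj₁ ≡.refl = ≤-refl
        ... | inj₂ k₁≼k   = ≼⇒d≤ (proj₂ (find-just (under? x) byHeight eq)) x⊒k k₁≼k

    κ-fixed : ∀ {k} → K k → κ k ≡ k
    κ-fixed {k} Kk = ≡.sym (d-definite (≤-trans (κ-nearest k Kk) (≤-reflexive (d-refl k))))

    -- The edge above `z` crosses from one cell to another.
    Change : V → Set
    Change z = z ≢ root × κ z ≢ κ (parent z)

    change? : Decidable Change
    change? z = ¬? (z ≟ root) ×-dec ¬? (κ z ≟ κ (parent z))

    change-near : ∀ {z} → Change z → near z ≡ just (κ z)
    change-near {z} (z≢r , κ≢) with choose-either z (near z) (κ (parent z))
    ... | inj₁ e = ⊥-elim (κ≢ (≡.trans (κ-step z≢r) e))
    ... | inj₂ e = ≡.trans e (cong just (≡.sym (κ-step z≢r)))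

    change-⊒ : ∀ {z} → Change z → z ⊒ κ z
    change-⊒ {z} ch = proj₂ (find-just (under? z) byHeight (change-near ch))

    below-change≢root : ∀ {z y} → Change z → z ⊒ y → y ≢ root
    below-change≢root (z≢r , _) z⊒y y≡r = z≢r (⊒root⇒≡ z⊒y y≡r)

    -- The centres under `y` are among those under `z`, so the first of them is still `κ z`. Whether
    -- `κ y` is inherited or equals `near y`, it is `κ z`.
    run : ∀ {z y} → Change z → z ⊒ y → y ⊒ κ z → κ y ≡ κ z
    run ch here _ = ≡.refl
    run {z} ch z⊒y@(up {y} z⊒py) y⊒k
      with choose-either y (near y) (κ (parent y))
         | find-⊆ (under? z) (under? y) (λ (Kk , p) → Kk , ⊒-trans z⊒y p) byHeight (change-near ch) (κ-∈ z , y⊒k)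
    ... | inj₁ e | _    = ≡.trans (κ-step (below-change≢root ch z⊒y))
                            (≡.trans e (run ch z⊒py (⊒-trans (parent⊒ y) y⊒k)))
    ... | inj₂ e | near≡ = ≡.trans (κ-step (below-change≢root ch z⊒y)) (just-injective (≡.trans (≡.sym e) near≡))

    no-change-in-run : ∀ {z y} → Change z → Change y → z ⊒ parent y → ¬ y ⊒ κ z
    no-change-in-run {z} {y} chz (_ , κ≢) z⊒py y⊒k =
      κ≢ (≡.trans (run chz (up z⊒py) y⊒k) (≡.sym (run chz z⊒py (⊒-trans (parent⊒ y) y⊒k))))

    -- Two change edges with one centre would both lie above it, and the lower would interrupt the
    -- run from the upper. So each cell hangs from at most one change edge, and there are at most as
    -- many changes as centres.
    change-injective : ∀ {y z} → Change y → Change z → κ y ≡ κ z → y ≡ z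
    change-injective {y} {z} chy chz eq with y ≟ z
    ... | yes e = e
    ... | no ne with comparable (subst (y ⊒_) eq (change-⊒ chy)) (change-⊒ chz)
    ...   | inj₁ p = ⊥-elim (no-change-in-run chy chz (proper⇒⊒parent p ne) (subst (z ⊒_) (≡.sym eq) (change-⊒ chz)))
    ...   | inj₂ p = ⊥-elim (no-change-in-run chz chy (proper⇒⊒parent p (λ e → ne (≡.sym e))) (subst (y ⊒_) eq (change-⊒ chy)))

    count-changes : ∀ {M} (code : ∀ {x} → K x → Fin M) →
                    (∀ {x y} (p : K x) (q : K y) → code p ≡ code q → x ≡ y) → count change? vertices ≤ℕ M
    count-changes code code-inj = count-injective change? (λ {z} _ → code (κ-∈ z))
      (λ chy chz eq → change-injective chy chz (code-inj (κ-∈ _) (κ-∈ _) eq)) (allFin⁺ N)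

    abstract
      -- A 2-colouring of the tree of cells: the parity of the number of change edges above a
      -- vertex.
      colour : V → Bool
      colour = inherit false (λ x b → if does (κ x ≟ κ (parent x)) then b else not b)

      colour-same : ∀ {x} → x ≢ root → κ x ≡ κ (parent x) → colour x ≡ colour (parent x)
      colour-same {x} x≢r eq
        rewrite inherit-step false (λ x b → if does (κ x ≟ κ (parent x)) then b else not b) x≢r
        with κ x ≟ κ (parent x)
      ... | yes _  = ≡.refl
      ... | no neq = ⊥-elim (neq eq)

      colour-change : ∀ {x} → Change x → colour x ≡ not (colour (parent x))
      colour-change {x} (x≢r , neq)
        rewrite inherit-step false (λ x b → if does (κ x ≟ κ (parent x)) then b else not b) x≢r
        with κ x ≟ κ (parent x)
      ... | yes eq = ⊥-elim (neq eq)
      ... | no _   = ≡.refl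

    colour-run : ∀ {z y} → Change z → z ⊒ y → y ⊒ κ z → colour y ≡ colour z
    colour-run ch here _ = ≡.refl
    colour-run ch z⊒y@(up {y} z⊒py) y⊒k = ≡.trans
      (colour-same (below-change≢root ch z⊒y) (≡.trans (run ch z⊒y y⊒k) (≡.sym (run ch z⊒py py⊒k))))
      (colour-run ch z⊒py py⊒k)
      where py⊒k = ⊒-trans (parent⊒ y) y⊒k

    -- Below a change edge, the run from `x` to `κ x` has one colour; elsewhere `x` takes both
    -- centre and colour from its parent. Hence the colour depends on the cell only.
    colour-κ : ∀ x → colour (κ x) ≡ colour x
    colour-κ = treeInd _ (cong colour κ-root) step
      where
      step : ∀ x → x ≢ root → colour (κ (parent x)) ≡ colour (parent x) → colour (κ x) ≡ colour x
      step x x≢r ih with κ x ≟ κ (parent x)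
      ... | yes e = ≡.trans (cong colour e) (≡.trans ih (≡.sym (colour-same x≢r e)))
      ... | no ne = colour-run (x≢r , ne) (change-⊒ (x≢r , ne)) here

    colour-cong : ∀ {x y} → κ x ≡ κ y → colour x ≡ colour y
    colour-cong {x} {y} eq = ≡.trans (≡.sym (colour-κ x)) (≡.trans (cong colour eq) (colour-κ y))

    -- The change edges met on the descent from `a` to `x`, counted up to two. In `many`, `z` is the
    -- upper and `y` the lower edge.
    data Changes (a x : V) : Set where
      none : κ x ≡ κ a → colour x ≡ colour a → Changes a x
      one  : ∀ {z} → Change z → z ⊒ x → a ⊒ parent z → colour x ≡ not (colour a) → Changes a x
      many : ∀ {y z} → Change y → Change z → z ⊒ parent y → y ⊒ x → a ⊒ parent z → Changes a x

    changes : ∀ {a x} → a ⊒ x → Changes a x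
    changes here = none ≡.refl ≡.refl
    changes {a} (up {x} p) with x ≟ root
    ... | yes ≡.refl = subst (Changes a) parent-root (changes p)
    ... | no x≢r with κ x ≟ κ (parent x) | changes p
    ...   | yes e | none k c            = none (≡.trans e k) (≡.trans (colour-same x≢r e) c)
    ...   | yes e | one ch q r c        = one ch (up q) r (≡.trans (colour-same x≢r e) c)
    ...   | yes _ | many ch ch′ q r s   = many ch ch′ q (up r) s
    ...   | no ne | none _ c            = one (x≢r , ne) here p (≡.trans (colour-change (x≢r , ne)) (cong not c))
    ...   | no ne | one ch q r _        = many (x≢r , ne) ch q here r
    ...   | no _  | many ch ch′ q r s   = many ch ch′ q (up r) s

    below-lca⋣ʳ : ∀ {x y z} → Change z → z ⊒ x → lca x y ⊒ parent z → ¬ z ⊒ y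
    below-lca⋣ʳ {x} {y} (z≢r , _) z⊒x a⊒pz z⊒y = ⋣parent z≢r (⊒-trans (lca-lowest x y z⊒x z⊒y) a⊒pz)

    below-lca⋣ˡ : ∀ {x y z} → Change z → z ⊒ y → lca x y ⊒ parent z → ¬ z ⊒ x
    below-lca⋣ˡ {x} {y} (z≢r , _) z⊒y a⊒pz z⊒x = ⋣parent z≢r (⊒-trans (lca-lowest x y z⊒x z⊒y) a⊒pz)

    change-on-path : ∀ {x y} → κ x ≢ κ y → ∃ λ z → OnPath x y z × Change z
    change-on-path {x} {y} ne with changes (lca⊒ˡ x y) | changes (lca⊒ʳ x y)
    ... | one ch p q _       | _                  = _ , inj₁ (p , below-lca⋣ʳ ch p q) , ch
    ... | many {y′} ch ch′ q r s | _              =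
      _ , inj₁ (⊒-trans q (⊒-trans (parent⊒ y′) r) , below-lca⋣ʳ ch′ (⊒-trans q (⊒-trans (parent⊒ y′) r)) s) , ch′
    ... | none _ _           | one ch p q _       = _ , inj₂ (p , below-lca⋣ˡ ch p q) , ch
    ... | none _ _           | many {y′} ch ch′ q r s =
      _ , inj₂ (⊒-trans q (⊒-trans (parent⊒ y′) r) , below-lca⋣ˡ ch′ (⊒-trans q (⊒-trans (parent⊒ y′) r)) s) , ch′
    ... | none e _           | none e′ _          = ⊥-elim (ne (≡.trans e (≡.sym e′)))

    -- lca (κ y) (κ z) lies in the cell of κ z, and a cell contains only one point of K.
    κ-above-lower-change : ∀ {y z} → Change y → Change z → z ⊒ parent y → κ z ⊒ parent y
    κ-above-lower-change {y} {z} chy chz z⊒py = proper (comparable κz⊒κy (change-⊒ chy))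
      where
      m = lca (κ y) (κ z)
      z⊒m : z ⊒ m
      z⊒m = lca-lowest (κ y) (κ z) (⊒-trans z⊒py (⊒-trans (parent⊒ y) (change-⊒ chy))) (change-⊒ chz)
      m≡κz : m ≡ κ z
      m≡κz = ≡.trans (≡.sym (κ-fixed (K-lca (κ-∈ y) (κ-∈ z)))) (run chz z⊒m (lca⊒ʳ (κ y) (κ z)))
      κz⊒κy : κ z ⊒ κ y
      κz⊒κy = subst (_⊒ κ y) m≡κz (lca⊒ˡ (κ y) (κ z))
      y⋣κz : ¬ y ⊒ κ z
      y⋣κz = no-change-in-run chz chy z⊒py
      proper : κ z ⊒ y ⊎ y ⊒ κ z → κ z ⊒ parent y
      proper (inj₁ p) = proper⇒⊒parent p (λ e → y⋣κz (subst (y ⊒_) (≡.sym e) here))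
      proper (inj₂ p) = ⊥-elim (y⋣κz p)

    -- The path leaves the cell of `κ z` through the edge above `y`, after passing `κ z` itself. As
    -- `z` is not above `w`, this happens on the leg towards `x`.
    between-many : ∀ {x w y z} → Change y → Change z → z ⊒ parent y → y ⊒ x → ¬ z ⊒ w → Between x w (κ z)
    between-many {x} {w} {y} {z} chy chz z⊒py y⊒x z⋣w = record { covers = covers ; within = within }
      where
      κz⊒x : κ z ⊒ x
      κz⊒x = ⊒-trans (κ-above-lower-change chy chz z⊒py) (⊒-trans (parent⊒ y) y⊒x)
      covers : ∀ {v} → v ⊒ x → v ⊒ w → v ⊒ κ z
      covers v⊒x v⊒w with comparable v⊒x (⊒-trans (change-⊒ chz) κz⊒x)
      ... | inj₁ v⊒z = ⊒-trans v⊒z (change-⊒ chz)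
      ... | inj₂ z⊒v = ⊥-elim (z⋣w (⊒-trans z⊒v v⊒w))
      within : ∀ {v} → v ⊒ κ z → v ⊒ x ⊎ v ⊒ w
      within v⊒k = inj₁ (⊒-trans v⊒k κz⊒x)

    -- The subtrees of `z` and `w` are disjoint and contain the two centres, so the lca of these
    -- centres lies above both subtrees, at the top of the path.
    between-lca : ∀ {x y z w} → Change z → Change w → z ⊒ x → ¬ z ⊒ y → w ⊒ y → ¬ w ⊒ x →
                  Between x y (lca (κ z) (κ w))
    between-lca {x} {y} {z} {w} chz chw z⊒x z⋣y w⊒y w⋣x = record { covers = covers ; within = within }
      where
      m = lca (κ z) (κ w)
      disjoint : ∀ {v} → z ⊒ v → ¬ w ⊒ v
      disjoint z⊒v w⊒v with comparable z⊒v w⊒v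
      ... | inj₁ z⊒w = z⋣y (⊒-trans z⊒w w⊒y)
      ... | inj₂ w⊒z = w⋣x (⊒-trans w⊒z z⊒x)
      m⊒z : m ⊒ z
      m⊒z with comparable (lca⊒ˡ (κ z) (κ w)) (change-⊒ chz)
      ... | inj₁ p = p
      ... | inj₂ p = ⊥-elim (disjoint (⊒-trans p (lca⊒ʳ (κ z) (κ w))) (change-⊒ chw))
      covers : ∀ {v} → v ⊒ x → v ⊒ y → v ⊒ m
      covers {v} v⊒x v⊒y = lca-lowest (κ z) (κ w) (⊒-trans v⊒z (change-⊒ chz)) (⊒-trans v⊒w (change-⊒ chw))
        where
        v⊒z : v ⊒ z
        v⊒z with comparable v⊒x z⊒x
        ... | inj₁ p = p
        ... | inj₂ p = ⊥-elim (z⋣y (⊒-trans p v⊒y))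
        v⊒w : v ⊒ w
        v⊒w with comparable v⊒y w⊒y
        ... | inj₁ p = p
        ... | inj₂ p = ⊥-elim (w⋣x (⊒-trans p v⊒x))
      within : ∀ {v} → v ⊒ m → v ⊒ x ⊎ v ⊒ y
      within v⊒m = inj₁ (⊒-trans v⊒m (⊒-trans m⊒z z⊒x))

    between-sym : ∀ {x y k} → Between x y k → Between y x k
    between-sym b = record { covers = λ p q → Between.covers b q p ; within = λ p → swap (Between.within b p) }

    -- Equal colours in different cells exclude exactly one change in total. Two on one leg enclose
    -- a centre; one on each leg makes the lca of two centres lie on the path, and this lca is in
    -- `K`.
    same-colour⇒between : ∀ {x y} → colour x ≡ colour y → κ x ≢ κ y → Σ V λ k → K k × Between x y k
    same-colour⇒between {x} {y} c≡ κ≢ with changes (lca⊒ˡ x y) | changes (lca⊒ʳ x y)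
    ... | none e _     | none e′ _    = ⊥-elim (κ≢ (≡.trans e (≡.sym e′)))
    ... | none _ c     | one _ _ _ c′ = ⊥-elim (not-¬ ≡.refl (≡.trans (≡.sym c) (≡.trans c≡ c′)))
    ... | one _ _ _ c  | none _ c′    = ⊥-elim (not-¬ ≡.refl (≡.trans (≡.sym c′) (≡.trans (≡.sym c≡) c)))
    ... | one ch p q _ | one ch′ p′ q′ _ =
      _ , K-lca (κ-∈ _) (κ-∈ _) , between-lca ch ch′ p (below-lca⋣ʳ ch p q) p′ (below-lca⋣ˡ ch′ p′ q′)
    ... | many {u} ch ch′ p q r | _ =
      _ , κ-∈ _ , between-many ch ch′ p q (below-lca⋣ʳ ch′ (⊒-trans p (⊒-trans (parent⊒ u) q)) r)
    ... | none _ _    | many {u} ch ch′ p q r =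
      _ , κ-∈ _ , between-sym (between-many ch ch′ p q (below-lca⋣ˡ ch′ (⊒-trans p (⊒-trans (parent⊒ u) q)) r))
    ... | one _ _ _ _ | many {u} ch ch′ p q r =
      _ , κ-∈ _ , between-sym (between-many ch ch′ p q (below-lca⋣ˡ ch′ (⊒-trans p (⊒-trans (parent⊒ u) q)) r))

  -- Lipschitz functions and McShane's extension

  Lipschitz : (V → Carrier) → Set ℓ₂
  Lipschitz g = ∀ x y → g x ≤ g y ∙ d x y

  minimum : (V → Carrier) → V → List V → Carrier
  minimum h x []       = h x
  minimum h x (y ∷ ys) with total (h x) (minimum h y ys)
  ... | inj₁ _ = h x
  ... | inj₂ _ = minimum h y ys

  minimum-≤ : ∀ h {x xs z} → z ∈ x ∷ xs → minimum h x xs ≤ h z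
  minimum-≤ h {x} {[]}     (here ≡.refl) = ≤-refl
  minimum-≤ h {x} {y ∷ ys} z∈ with total (h x) (minimum h y ys)
  minimum-≤ h {x} {y ∷ ys} (here ≡.refl) | inj₁ _ = ≤-refl
  minimum-≤ h {x} {y ∷ ys} (there z∈)    | inj₁ p = ≤-trans p (minimum-≤ h z∈)
  minimum-≤ h {x} {y ∷ ys} (here ≡.refl) | inj₂ p = p
  minimum-≤ h {x} {y ∷ ys} (there z∈)    | inj₂ _ = minimum-≤ h z∈

  minimum-attained : ∀ h x xs → Σ V λ z → z ∈ x ∷ xs × minimum h x xs ≡ h z
  minimum-attained h x []       = x , here ≡.refl , ≡.refl
  minimum-attained h x (y ∷ ys) with total (h x) (minimum h y ys)
  ... | inj₁ _ = x , here ≡.refl , ≡.refl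
  ... | inj₂ _ with minimum-attained h y ys
  ...   | z , z∈ , eq = z , there z∈ , eq

  module McShane {p : Level} {S : Pred V p} (S? : Decidable S) (S-root : S root) (f : V → Carrier)
                 (f-lipschitz : ∀ {x y} → S x → S y → f x ≤ f y ∙ d x y) where

    points : List V
    points = filter S? (allFin N)

    ∈S : ∀ {z} → z ∈ root ∷ points → S z
    ∈S (here ≡.refl) = S-root
    ∈S (there z∈)    = proj₂ (∈-filter⁻ S? {xs = allFin N} z∈)

    S∈ : ∀ {z} → S z → z ∈ root ∷ points
    S∈ Sz = there (∈-filter⁺ S? (∈-allFin _) Sz)

    -- McShane's formula. Listing the root first keeps the minimum over a non-empty list.
    extension : V → Carrier
    extension y = minimum (λ z → f z ∙ d z y) root points

    extension-lipschitz : Lipschitz extension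
    extension-lipschitz x y with minimum-attained (λ z → f z ∙ d z y) root points
    ... | z , z∈ , eq rewrite eq = begin
      extension x             ≤⟨ minimum-≤ (λ z → f z ∙ d z x) z∈ ⟩
      f z ∙ d z x             ≤⟨ ∙-monoʳ-≤ (f z) (d-triangle z y x) ⟩
      f z ∙ (d z y ∙ d y x)   ≈⟨ ∙-congˡ (∙-congˡ (d-sym y x)) ⟩
      f z ∙ (d z y ∙ d x y)   ≈⟨ assoc (f z) (d z y) (d x y) ⟨
      (f z ∙ d z y) ∙ d x y   ∎
      where open ≤-Reasoning

    extension-on-S : ∀ {x} → S x → extension x ≈ f x
    extension-on-S {x} Sx = antisym
      (≤-trans (minimum-≤ (λ z → f z ∙ d z x) (S∈ Sx)) (≤-reflexive (trans (∙-congˡ (d-refl x)) (identityʳ (f x)))))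
      below
      where
      below : f x ≤ extension x
      below with minimum-attained (λ z → f z ∙ d z x) root points
      ... | z , z∈ , eq rewrite eq =
        ≤-trans (f-lipschitz Sx (∈S z∈)) (≤-reflexive (∙-congˡ (d-sym x z)))

  -- |g u - g v| = d(u, v), written without an absolute value.
  Realised : V → V → (V → Carrier) → Set ℓ₁
  Realised u v g = (g v ≈ g u ∙ d u v) ⊎ (g u ≈ g v ∙ d u v)

  -- The functions of one stage

  module StageFunctions (K : Pred V 0ℓ) (K? : Decidable K) (K-root : K root)
                        (K-lca : ∀ {a b} → K a → K b → K (lca a b)) where
    open Voronoi K K? K-root K-lca

    module _ (σ : V → Bool) (s : Bool) where
      private
        φ : V → Carrier
        φ = potential σ

      S : V → Set
      S x = colour x ≡ s ⊎ K x

      S? : Decidable S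
      S? x = (colour x ≟B s) ⊎-dec K? x

      f : V → Carrier
      f x = φ x − φ (κ x)

      -- If an endpoint is in `K`, it serves itself; otherwise both cells have colour `s`.
      S-between : ∀ {x y} → S x → S y → κ x ≢ κ y → Σ V λ k → K k × Between x y k
      S-between (inj₁ cx) (inj₁ cy) ne = same-colour⇒between (≡.trans cx (≡.sym cy)) ne
      S-between {x} (inj₂ Kx) _ ne = x , Kx , record { covers = λ p _ → p ; within = inj₁ }
      S-between {y = y} (inj₁ _) (inj₂ Ky) ne = y , Ky , record { covers = λ _ p → p ; within = inj₂ }

      f≤ : ∀ x {k} → K k → f x ≤ d x k
      f≤ x Kk = ≤-trans (≤∙⇒−≤ (potential-lipschitz σ x (κ x))) (κ-nearest x Kk)

      ε≤f∙d : ∀ x {k} → K k → ε ≤ f x ∙ d k x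
      ε≤f∙d x {k} Kk = begin
        ε                        ≈⟨ inverseʳ (φ (κ x)) ⟨
        φ (κ x) − φ (κ x)        ≤⟨ ≤-compat (φ (κ x) ⁻¹) (potential-lipschitz σ (κ x) x) ⟩
        (φ x ∙ d (κ x) x) − φ (κ x)  ≈⟨ [x∙z]−y≈[x−y]∙z _ _ _ ⟩
        f x ∙ d (κ x) x          ≈⟨ ∙-congˡ (d-sym (κ x) x) ⟩
        f x ∙ d x (κ x)          ≤⟨ ∙-monoʳ-≤ (f x) (κ-nearest x Kk) ⟩
        f x ∙ d x k              ≈⟨ ∙-congˡ (d-sym x k) ⟩
        f x ∙ d k x              ∎
        where open ≤-Reasoning

      -- Within a cell the normalising constants cancel. Between cells, a point `k` of `K` on the
      -- path gives f(x) ≤ d(x, k) and -f(y) ≤ d(k, y), and these distances add up to d(x, y).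
      f-lipschitz : ∀ {x y} → S x → S y → f x ≤ f y ∙ d x y
      f-lipschitz {x} {y} Sx Sy with κ x ≟ κ y
      ... | yes eq rewrite eq = begin
        φ x − φ (κ y)            ≤⟨ ≤-compat (φ (κ y) ⁻¹) (potential-lipschitz σ x y) ⟩
        (φ y ∙ d x y) − φ (κ y)  ≈⟨ [x∙z]−y≈[x−y]∙z _ _ _ ⟩
        (φ y − φ (κ y)) ∙ d x y  ∎
        where open ≤-Reasoning
      ... | no ne with S-between Sx Sy ne
      ...   | k , Kk , b = begin
        f x                        ≤⟨ f≤ x Kk ⟩
        d x k                      ≤⟨ y≤x∙y (ε≤f∙d y Kk) ⟩
        (f y ∙ d k y) ∙ d x k      ≈⟨ assoc (f y) (d k y) (d x k) ⟩
        f y ∙ (d k y ∙ d x k)      ≈⟨ ∙-congˡ (comm (d k y) (d x k)) ⟩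
        f y ∙ (d x k ∙ d k y)      ≈⟨ ∙-congˡ (d-between b) ⟨
        f y ∙ d x y                ∎
        where open ≤-Reasoning

      open McShane S? (inj₂ K-root) f f-lipschitz using (extension; extension-lipschitz; extension-on-S)

      abstract
        stageFunction : V → Carrier
        stageFunction = extension

        stageFunction-lipschitz : Lipschitz stageFunction
        stageFunction-lipschitz = extension-lipschitz

        stageFunction-vanishes : ∀ {k} → K k → stageFunction k ≈ ε
        stageFunction-vanishes {k} Kk = trans (extension-on-S (inj₂ Kk))
          (trans (reflexive (cong (λ y → φ k − φ y) (κ-fixed Kk))) (inverseʳ (φ k)))

        stageFunction-in-cell : ∀ {x} → colour x ≡ s → stageFunction x ≈ φ x − φ (κ x)
        stageFunction-in-cell cx = extension-on-S (inj₁ cx)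

    -- Both values are normalised at the same centre, so the difference of potentials survives.
    opposite⇒≈ : ∀ {σ u v} → κ u ≡ κ v → Opposite σ u v →
                 stageFunction σ (colour u) v ≈ stageFunction σ (colour u) u ∙ d u v
    opposite⇒≈ {σ} {u} {v} eq opp = begin-equality
      stageFunction σ (colour u) v                         ≈⟨ stageFunction-in-cell σ (colour u) (colour-cong (≡.sym eq)) ⟩
      potential σ v − potential σ (κ v)                    ≈⟨ ∙-congʳ (potential-opposite opp) ⟩
      (potential σ u ∙ d u v) − potential σ (κ v)          ≈⟨ [x∙z]−y≈[x−y]∙z _ _ _ ⟩
      (potential σ u − potential σ (κ v)) ∙ d u v          ≈⟨ ∙-congʳ (reflexive (cong (λ y → potential σ u − potential σ y) (≡.sym eq))) ⟩
      (potential σ u − potential σ (κ u)) ∙ d u v          ≈⟨ ∙-congʳ (stageFunction-in-cell σ (colour u) ≡.refl) ⟨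
      stageFunction σ (colour u) u ∙ d u v                 ∎
      where open ≤-Reasoning

    realises⇒Realised : ∀ {σ u v} → κ u ≡ κ v → Realises σ u v → Realised u v (stageFunction σ (colour u))
    realises⇒Realised eq (inj₁ opp) = inj₁ (opposite⇒≈ eq opp)
    realises⇒Realised {σ} {u} {v} eq (inj₂ opp) =
      inj₂ (subst (λ s → stageFunction σ s u ≈ stageFunction σ s v ∙ d u v) (colour-cong (≡.sym eq))
        (trans (opposite⇒≈ (≡.sym eq) opp) (∙-congˡ (d-sym v u))))

    -- Each pattern is used once for either colour, since a pair to be realised may lie in a cell of
    -- any colour.
    stage : List (V → Bool) → List (V → Carrier)
    stage σs = map (λ σ → stageFunction σ true) σs ++ map (λ σ → stageFunction σ false) σs

    length-stage : ∀ σs → length (stage σs) ≡ length σs + length σs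
    length-stage σs = ≡.trans (length-++ (map _ σs)) (≡.cong₂ _+_ (length-map _ σs) (length-map _ σs))

    stage-all : ∀ {ℓ} {P : Pred (V → Carrier) ℓ} → (∀ σ s → P (stageFunction σ s)) → ∀ σs → All P (stage σs)
    stage-all p σs = All.++⁺ (All.map⁺ (All.universal (λ σ → p σ true) σs)) (All.map⁺ (All.universal (λ σ → p σ false) σs))

    stage-∈ : ∀ {σ σs} s → σ ∈ σs → stageFunction σ s ∈ stage σs
    stage-∈ true  σ∈ = ∈-++⁺ˡ (∈-map⁺ (λ σ → stageFunction σ true) σ∈)
    stage-∈ false σ∈ = ∈-++⁺ʳ _ (∈-map⁺ (λ σ → stageFunction σ false) σ∈)

  -- Assembling the coordinates

  module Assembly (root-first : toℕ root ≡ 0) where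

    -- The closure under lca of the first `k` vertices; lcas of pairs suffice by `lca-lca`.
    Centres : ℕ → V → Set
    Centres k z = Σ V λ a → Σ V λ b → toℕ a <ℕ k × toℕ b <ℕ k × lca a b ≡ z

    centres? : ∀ k → Decidable (Centres k)
    centres? k z = any? λ a → any? λ b → (toℕ a ℕ.<? k) ×-dec ((toℕ b ℕ.<? k) ×-dec (lca a b ≟ z))

    lca-idem : ∀ x → lca x x ≡ x
    lca-idem x = lca-unique here here (λ p _ → p)

    prior∈Centres : ∀ {k x} → toℕ x <ℕ k → Centres k x
    prior∈Centres {x = x} lt = x , x , lt , lt , lca-idem x

    root∈Centres : ∀ {k} → 0 <ℕ k → Centres k root
    root∈Centres lt = prior∈Centres (subst (_<ℕ _) (≡.sym root-first) lt)

    Centres-lca : ∀ {k a b} → Centres k a → Centres k b → Centres k (lca a b)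
    Centres-lca (a , b , a< , b< , ≡.refl) (c , f , c< , f< , ≡.refl) with lca-lca a b c f
    ... | inj₁ eq        = a , b , a< , b< , ≡.sym eq
    ... | inj₂ (inj₁ eq) = c , f , c< , f< , ≡.sym eq
    ... | inj₂ (inj₂ eq) = a , c , a< , c< , ≡.sym eq

    Centres-mono : ∀ {k l x} → k ≤ℕ l → Centres k x → Centres l x
    Centres-mono le (a , b , a< , b< , eq) = a , b , ℕ.<-≤-trans a< le , ℕ.<-≤-trans b< le , eq

    -- A centre is named by a pair of the first `k` vertices, so there are at most k² centres.
    code : ∀ {k x} → Centres k x → Fin (k * k)
    code (a , b , a< , b< , _) = combine (fromℕ< a<) (fromℕ< b<)

    fromℕ<-cancel : ∀ {k} {a b : V} (p : toℕ a <ℕ k) (q : toℕ b <ℕ k) → fromℕ< p ≡ fromℕ< q → a ≡ b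
    fromℕ<-cancel p q eq = toℕ-injective (≡.trans (≡.sym (toℕ-fromℕ< p)) (≡.trans (cong toℕ eq) (toℕ-fromℕ< q)))

    code-injective : ∀ {k x y} (p : Centres k x) (q : Centres k y) → code p ≡ code q → x ≡ y
    code-injective (a , b , a< , b< , ≡.refl) (a′ , b′ , a′< , b′< , ≡.refl) eq
      with combine-injective (fromℕ< a<) (fromℕ< b<) (fromℕ< a′<) (fromℕ< b′<) eq
    ... | eq₁ , eq₂ = cong₂ lca (fromℕ<-cancel a< a′< eq₁) (fromℕ<-cancel b< b′< eq₂)

    K : ℕ → V → Set
    K i = Centres (2 ^ expo i)

    module Tier (i : ℕ) where
      open Voronoi (K i) (centres? (2 ^ expo i)) (root∈Centres (ℕ.m^n>0 2 (expo i))) Centres-lca public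
      open StageFunctions (K i) (centres? (2 ^ expo i)) (root∈Centres (ℕ.m^n>0 2 (expo i))) Centres-lca public

      -- With e = `expo i` there are at most (2^e)² changes; one further factor 2 makes the bound
      -- strict.
      few-changes : count change? vertices <ℕ 2 ^ suc (2 * expo i)
      few-changes = ℕ.≤-<-trans (count-changes code code-injective)
        (ℕ.≤-<-trans (ℕ.≤-reflexive (≡.trans (≡.sym (ℕ.^-distribˡ-+-* 2 (expo i) (expo i))) (cong (λ k → 2 ^ (expo i + k)) (≡.sym (ℕ.+-identityʳ (expo i))))))
          (ℕ.^-monoʳ-< 2 (s≤s (s≤s z≤n)) {2 * expo i} {suc (2 * expo i)} ℕ.≤-refl))

    module _ (i : ℕ) where
      private
        module Here = Tier i
        module Next = Tier (suc i)
      abstract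
        signs : Σ (List (V → Bool)) λ σs → length σs ≡ suc (2 * suc (2 * expo (suc i))) ×
          (∀ {u v} → ∃ (λ x → OnPath u v x × Next.Change x) → Σ (V → Bool) λ σ → σ ∈ σs × Realises σ u v)
        signs = separatingSigns Next.change? (suc (2 * expo (suc i))) Next.few-changes

      level : List (V → Carrier)
      level = Here.stage (proj₁ signs)

      -- Each colour contributes 1 + 2B functions, where B = 2 `expo (suc i)` + 1 = 4 `expo i` + 3.
      length-level : length level ≡ 14 + 16 * expo i
      length-level = ≡.trans (Here.length-stage (proj₁ signs))
        (≡.trans (cong₂ _+_ (proj₁ (proj₂ signs)) (proj₁ (proj₂ signs))) (arith (expo i)))
        where
        arith : ∀ n → suc (2 * suc (2 * suc (2 * n))) + suc (2 * suc (2 * suc (2 * n))) ≡ 14 + 16 * n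
        arith = solve 1 (λ n → let m = con 1 :+ con 2 :* (con 1 :+ con 2 :* (con 1 :+ con 2 :* n)) in
          m :+ m := con 14 :+ con 16 :* n) ≡.refl

      level-lipschitz : All Lipschitz level
      level-lipschitz = Here.stage-all {P = Lipschitz} Here.stageFunction-lipschitz (proj₁ signs)

      level-vanishes : ∀ {x} → K i x → All (λ g → g x ≈ ε) level
      level-vanishes {x} Kx = Here.stage-all {P = λ g → g x ≈ ε} (λ σ s → Here.stageFunction-vanishes σ s Kx) (proj₁ signs)

      -- The two sets of centres play different roles: the patterns separate the change edges of
      -- `Next`, while the normalisation uses the cells of `Here`.
      level-realises : ∀ {u v} → Here.κ u ≡ Here.κ v → Next.κ u ≢ Next.κ v → Any (Realised u v) level
      level-realises {u} eq ne = let σ , σ∈ , r = proj₂ (proj₂ signs) (Next.change-on-path ne) in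
        lose (Here.stage-∈ (Here.colour u) σ∈) (Here.realises⇒Realised eq r)

    levels : ℕ → ℕ → List (V → Carrier)
    levels i zero    = []
    levels i (suc n) = level i ++ levels (suc i) n

    levels-lipschitz : ∀ i n → All Lipschitz (levels i n)
    levels-lipschitz i zero    = []
    levels-lipschitz i (suc n) = All.++⁺ (level-lipschitz i) (levels-lipschitz (suc i) n)

    K-mono : ∀ i {x} → K i x → K (suc i) x
    K-mono i = Centres-mono (ℕ.^-monoʳ-≤ 2 (expo-step i))

    levels-vanish : ∀ i n {x} → K i x → All (λ g → g x ≈ ε) (levels i n)
    levels-vanish i zero    Kx = []
    levels-vanish i (suc n) Kx = All.++⁺ (level-vanishes i Kx) (levels-vanish (suc i) n (K-mono i Kx))

    -- Some stage is the first to put `u` and `v` into different cells; the level just before it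
    -- realises them.
    levels-realise : ∀ i n {u v} → Tier.κ i u ≡ Tier.κ i v → Tier.κ (i + n) u ≢ Tier.κ (i + n) v →
                     Any (Realised u v) (levels i n)
    levels-realise i zero eq ne = ⊥-elim (ne (subst (λ j → Tier.κ j _ ≡ Tier.κ j _) (≡.sym (ℕ.+-identityʳ i)) eq))
    levels-realise i (suc n) {u} {v} eq ne with Tier.κ (suc i) u ≟ Tier.κ (suc i) v
    ... | no ne′  = Any.++⁺ˡ (level-realises i eq ne′)
    ... | yes eq′ = Any.++⁺ʳ (level i) (levels-realise (suc i) n eq′
                      (subst (λ j → Tier.κ j u ≢ Tier.κ j v) (ℕ.+-suc i n) ne))

    coordinate : List (V → Carrier) → ℕ → V → Carrier
    coordinate []       t       x = ε
    coordinate (g ∷ gs) zero    x = g x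
    coordinate (g ∷ gs) (suc t) x = coordinate gs t x

    coordinate-++ : ∀ gs {hs t} → length gs ≤ℕ t → coordinate (gs ++ hs) t ≡ coordinate hs (t ∸ length gs)
    coordinate-++ []       le       = ≡.refl
    coordinate-++ (g ∷ gs) (s≤s le) = coordinate-++ gs le

    coordinate-lipschitz : ∀ {gs} → All Lipschitz gs → ∀ t → Lipschitz (coordinate gs t)
    coordinate-lipschitz []       t       x y = ≤-trans (d-nonneg x y) (≤-reflexive (sym (identityˡ (d x y))))
    coordinate-lipschitz (l ∷ ls) zero    x y = l x y
    coordinate-lipschitz (l ∷ ls) (suc t) x y = coordinate-lipschitz ls t x y

    coordinate-vanishes : ∀ {gs x} → All (λ g → g x ≈ ε) gs → ∀ t → coordinate gs t x ≈ ε
    coordinate-vanishes []       t       = refl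
    coordinate-vanishes (z ∷ zs) zero    = z
    coordinate-vanishes (z ∷ zs) (suc t) = coordinate-vanishes zs t

    coordinate-any : ∀ {p} {P : Pred (V → Carrier) p} {gs} → Any P gs → Σ ℕ λ t → P (coordinate gs t)
    coordinate-any (here p)  = 0 , p
    coordinate-any (there q) with coordinate-any q
    ... | t , p = suc t , p

    -- Levels i, …, i + l − 1 occupy at most 16 (expo (i + l) − expo i) coordinates.
    late-coordinate-vanishes : ∀ l i n {t x} → K (i + l) x → 16 * expo (i + l) ≤ℕ t + 16 * expo i →
                               coordinate (levels i n) t x ≈ ε
    late-coordinate-vanishes zero    i n {t} Kx _ =
      -- All levels from `i` on vanish at a point of `K i`.
      coordinate-vanishes (levels-vanish i n (subst (λ j → K j _) (ℕ.+-identityʳ i) Kx)) t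
    late-coordinate-vanishes (suc l) i zero Kx _ = refl
    late-coordinate-vanishes (suc l) i (suc n) {t} {x} Kx late =
      trans (reflexive (cong (λ g → g x) (coordinate-++ (level i) len≤t)))
        (late-coordinate-vanishes l (suc i) n (subst (λ j → K j x) (ℕ.+-suc i l) Kx) late′)
      where
      len = length (level i)
      late₁ : 16 * expo (suc i + l) ≤ℕ t + 16 * expo i
      late₁ = subst (λ j → 16 * expo j ≤ℕ t + 16 * expo i) (ℕ.+-suc i l) late
      -- A level has 14 + 16 e coordinates for e = `expo i`, two fewer than its allotment 16
      -- (`expo (suc i)` - e) = 16 + 16 e. These allotments telescope.
      arith₁ : ∀ n → (14 + 16 * n) + 16 * n + 2 ≡ 16 * suc (2 * n)
      arith₁ = solve 1 (λ n → con 14 :+ con 16 :* n :+ con 16 :* n :+ con 2 := con 16 :* (con 1 :+ con 2 :* n)) ≡.refl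
      len≤t : len ≤ℕ t
      len≤t = ℕ.+-cancelʳ-≤ (16 * expo i) len t (ℕ.≤-trans (ℕ.≤-reflexive (cong (_+ 16 * expo i) (length-level i)))
        (ℕ.≤-trans (ℕ.m≤m+n _ 2) (ℕ.≤-trans (ℕ.≤-reflexive (arith₁ (expo i)))
          (ℕ.≤-trans (ℕ.*-monoʳ-≤ 16 (expo-mono (suc i) l)) late₁))))
      arith₂ : ∀ s n → (s + (14 + 16 * n)) + 16 * n + 2 ≡ s + 16 * suc (2 * n)
      arith₂ = solve 2 (λ s n → s :+ (con 14 :+ con 16 :* n) :+ con 16 :* n :+ con 2 := s :+ con 16 :* (con 1 :+ con 2 :* n)) ≡.refl
      late′ : 16 * expo (suc i + l) ≤ℕ (t ∸ len) + 16 * expo (suc i)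
      late′ = ℕ.≤-trans late₁ (ℕ.≤-trans (ℕ.m≤m+n (t + 16 * expo i) 2) (ℕ.≤-reflexive (≡.trans
        (cong (λ s → s + 16 * expo i + 2) (≡.trans (≡.sym (ℕ.m∸n+n≡m len≤t)) (cong ((t ∸ len) +_) (length-level i))))
        (arith₂ (t ∸ len) (expo i)))))

    embedding : V → ℕ → Carrier
    embedding x t = coordinate (levels 0 N) t x

    embedding-lipschitz : ∀ t → Lipschitz (λ x → embedding x t)
    embedding-lipschitz = coordinate-lipschitz (levels-lipschitz 0 N)

    -- At stage 0 there is one cell, and at stage `N` every vertex is its own centre, so distinct
    -- vertices are separated in between.
    embedding-realises : ∀ {u v} → u ≢ v → Σ ℕ λ t → Realised u v (λ x → embedding x t)
    embedding-realises {u} {v} u≢v = coordinate-any (levels-realise 0 N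
      (≡.trans (single u) (≡.sym (single v))) (λ eq → u≢v (≡.trans (≡.sym (all u)) (≡.trans eq (all v)))))
      where
      -- As 2 ^ `expo 0` is 1, only the root can occur in the pair behind a centre.
      single : ∀ x → Tier.κ 0 x ≡ root
      single x with Tier.κ-∈ 0 x
      ... | a , b , s≤s a≤0 , s≤s b≤0 , eq = ≡.trans (≡.sym eq) (≡.trans (cong₂ lca (first a≤0) (first b≤0)) (lca-idem root))
        where
        first : ∀ {y : V} → toℕ y ≤ℕ 0 → y ≡ root
        first le = toℕ-injective (≡.trans (ℕ.n≤0⇒n≡0 le) (≡.sym root-first))
      all : ∀ x → Tier.κ N x ≡ x
      all x = Tier.κ-fixed N (prior∈Centres (ℕ.<-trans (toℕ<n x) (ℕ.<-≤-trans (n<2^n N) (ℕ.^-monoʳ-≤ 2 (i≤expo N)))))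

    -- With j = `suc (toℕ x)`, choose `i` with 1 + ⌊log₂ j⌋ ≤ `expo i` ≤ 2 (1 + ⌊log₂ j⌋). The lower
    -- bound puts `x` into `K i`; the upper bound gives 16 · 2 = 32.
    embedding-prioritized : ∀ x t → logBound 32 (suc (toℕ x)) ≤ℕ t → embedding x t ≈ ε
    embedding-prioritized x t le with expo-between ⌊log₂ suc (toℕ x) ⌋
    ... | i , lo , hi = late-coordinate-vanishes i 0 N
      (prior∈Centres (ℕ.<-trans ℕ.≤-refl (ℕ.<-≤-trans (n<2^[1+log₂n] (suc (toℕ x))) (ℕ.^-monoʳ-≤ 2 lo))))
      (ℕ.≤-trans (ℕ.*-monoʳ-≤ 16 hi) (ℕ.≤-trans (ℕ.≤-reflexive (≡.sym (ℕ.*-assoc 16 2 (suc ⌊log₂ suc (toℕ x) ⌋))))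
        (ℕ.≤-trans le (ℕ.≤-reflexive (≡.sym (ℕ.+-identityʳ t))))))

-- Walks in acyclic graphs

module _ {a : Level} {n : ℕ} {Adj : Fin n → Fin n → Set a} where
  open Data.List.Membership.DecPropositional (_≟_ {n}) using (_∈?_)

  private
    vs : ∀ {u v} → Walk Adj u v → List (Fin n)
    vs = walkVertices Adj

  start-∈ : ∀ {u v} (p : Walk Adj u v) → u ∈ vs p
  start-∈ []      = here ≡.refl
  start-∈ (_ ∷ _) = here ≡.refl

  end-∈ : ∀ {u v} (p : Walk Adj u v) → v ∈ vs p
  end-∈ []      = here ≡.refl
  end-∈ (_ ∷ p) = there (end-∈ p)

  _++ʷ_ : ∀ {u v t} → Walk Adj u v → Walk Adj v t → Walk Adj u t
  []      ++ʷ q = q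
  (e ∷ p) ++ʷ q = e ∷ (p ++ʷ q)

  ++ʷ-∈ : ∀ {u v t z} (p : Walk Adj u v) (q : Walk Adj v t) → z ∈ vs (p ++ʷ q) → z ∈ vs p ⊎ z ∈ vs q
  ++ʷ-∈ []      q z∈         = inj₂ z∈
  ++ʷ-∈ (_ ∷ p) q (here eq)  = inj₁ (here eq)
  ++ʷ-∈ (_ ∷ p) q (there z∈) with ++ʷ-∈ p q z∈
  ... | inj₁ m = inj₁ (there m)
  ... | inj₂ m = inj₂ m

  prefix : ∀ {u v z} (p : Walk Adj u v) → z ∈ vs p → Σ (Walk Adj u z) λ q → ∀ {x} → x ∈ vs q → x ∈ vs p
  prefix []      (here ≡.refl) = [] , λ m → m
  prefix (_ ∷ p) (here ≡.refl) = [] , λ { (here eq) → here eq }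
  prefix (e ∷ p) (there z∈) with prefix p z∈
  ... | q , q⊆p = e ∷ q , λ { (here eq) → here eq ; (there m) → there (q⊆p m) }

  suffix : ∀ {u v z} (p : Walk Adj u v) → Unique (vs p) → z ∈ vs p →
           Σ (Walk Adj z v) λ q → Unique (vs q) × (∀ {x} → x ∈ vs q → x ∈ vs p)
  suffix []      uq       (here ≡.refl) = [] , uq , λ m → m
  suffix (e ∷ p) uq       (here ≡.refl) = e ∷ p , uq , λ m → m
  suffix (_ ∷ p) (_ ∷ uq) (there z∈) with suffix p uq z∈
  ... | q , uq′ , q⊆p = q , uq′ , λ m → there (q⊆p m)

  loopErase : ∀ {u v} (p : Walk Adj u v) → Σ (Walk Adj u v) λ q → Unique (vs q) × (∀ {x} → x ∈ vs q → x ∈ vs p)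
  loopErase [] = [] , [] ∷ [] , λ m → m
  loopErase {u} (e ∷ p) with loopErase p
  ... | q , uq , q⊆p with u ∈? vs q
  ...   | no u∉q  = e ∷ q , All.¬Any⇒All¬ (vs q) u∉q ∷ uq , λ { (here eq) → here eq ; (there m) → there (q⊆p m) }
  ...   | yes u∈q with suffix q uq u∈q
  ...     | r , ur , r⊆q = r , ur , λ m → there (q⊆p (r⊆q m))

  module _ (adj-sym : ∀ {u v} → Adj u v → Adj v u) where

    reverseʷ : ∀ {u v} → Walk Adj u v → Walk Adj v u
    reverseʷ []      = []
    reverseʷ (e ∷ p) = reverseʷ p ++ʷ (adj-sym e ∷ [])

    reverseʷ-∈ : ∀ {u v z} (p : Walk Adj u v) → z ∈ vs (reverseʷ p) → z ∈ vs p
    reverseʷ-∈ []      z∈ = z∈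
    reverseʷ-∈ (e ∷ p) z∈ with ++ʷ-∈ (reverseʷ p) (adj-sym e ∷ []) z∈
    ... | inj₁ m                  = there (reverseʷ-∈ p m)
    ... | inj₂ (here ≡.refl)      = there (start-∈ p)
    ... | inj₂ (there (here eq))  = here eq

    module _ (acyclic : ¬ HasCycle Adj) where

      -- Otherwise the loop-erased walk from `a` to `b`, closed up through `u`, is a cycle.
      same-neighbour : ∀ {u a b} → Adj u a → Adj u b → (p : Walk Adj a b) → u ∉ vs p → a ≡ b
      same-neighbour {u} {a} {b} ua ub p u∉p with a ≟ b
      ... | yes eq = eq
      ... | no a≢b with loopErase p
      ...   | [] , _ , _ = ⊥-elim (a≢b ≡.refl)
      ...   | q@(_ ∷ _) , uq , q⊆p =
        ⊥-elim (acyclic (u , b , ua ∷ q , All.¬Any⇒All¬ (vs q) (λ m → u∉p (q⊆p m)) ∷ uq , s≤s (s≤s z≤n) , adj-sym ub))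

      -- Go from a to the common end r and back to b.
      same-first-step : ∀ {u a b r} → Adj u a → Adj u b → (p : Walk Adj a r) (q : Walk Adj b r) →
                        u ∉ vs p → u ∉ vs q → a ≡ b
      same-first-step ua ub p q u∉p u∉q = same-neighbour ua ub (p ++ʷ reverseʷ q) u∉
        where
        u∉ : _ ∉ vs (p ++ʷ reverseʷ q)
        u∉ m with ++ʷ-∈ p (reverseʷ q) m
        ... | inj₁ m′ = u∉p m′
        ... | inj₂ m′ = u∉q (reverseʷ-∈ q m′)

      -- First steps agree, and so on inductively. Only lengths are compared, since an adjacency may
      -- have several proofs and the walks need not be equal.
      unique-length : ∀ {u r} (p q : Walk Adj u r) → Unique (vs p) → Unique (vs q) →
                      walkLength Adj p ≡ walkLength Adj q
      unique-length []      []      _ _  = ≡.refl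
      unique-length []      (_ ∷ q) _ uq = ⊥-elim (fresh uq (end-∈ q))
      unique-length (_ ∷ p) []      pu _ = ⊥-elim (fresh pu (end-∈ p))
      unique-length (a ∷ p) (b ∷ q) pu@(_ ∷ pu′) uq@(_ ∷ uq′)
        with same-first-step a b p q (fresh pu) (fresh uq)
      ... | ≡.refl = cong suc (unique-length p q pu′ uq′)

-- Rooting a weighted tree and identifying its metric

module Rooting {c ℓ₁ ℓ₂ : Level} {G : OrderedAbelianGroup c ℓ₁ ℓ₂} {m : ℕ} (T : WeightedTree G (suc m)) where
  open OrderedGroup G
  open WeightedTree T
  open Data.List.Membership.DecPropositional (_≟_ {suc m}) using (_∈?_)

  private
    vs : ∀ {u v} → Walk Adj u v → List (Fin (suc m))
    vs = walkVertices Adj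

  path : ∀ x → Walk Adj x zero
  path x = proj₁ (loopErase (connected x zero))

  path-unique : ∀ x → Unique (vs (path x))
  path-unique x = proj₁ (proj₂ (loopErase (connected x zero)))

  next : ∀ {x y} → Walk Adj x y → Fin (suc m)
  next {x} []              = x
  next (_∷_ {v = v} _ _)   = v

  next-loop : ∀ {x} (p : Walk Adj x x) → Unique (vs p) → next p ≡ x × walkLength Adj p ≡ 0
  next-loop []      _ = ≡.refl , ≡.refl
  next-loop (_ ∷ p) u = ⊥-elim (fresh u (end-∈ p))

  next-adj : ∀ {x y} (p : Walk Adj x y) → x ≢ y → Adj x (next p)
  next-adj []      x≢y = ⊥-elim (x≢y ≡.refl)
  next-adj (e ∷ _) _   = e

  -- The chosen path of the next vertex need not be the tail of `p`, but both are simple walks to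
  -- the root and hence equally long.
  next-length : ∀ {x} (p : Walk Adj x zero) → Unique (vs p) → x ≢ zero →
                walkLength Adj p ≡ suc (walkLength Adj (path (next p)))
  next-length []      _       x≢0 = ⊥-elim (x≢0 ≡.refl)
  next-length (_ ∷ p) (_ ∷ u) _   = cong suc (unique-length adj-sym acyclic p (path _) u (path-unique _))

  rooted : RootedTree (suc m)
  rooted = record
    { root         = zero
    ; parent       = λ x → next (path x)
    ; depth        = λ x → walkLength Adj (path x)
    ; parent-root  = proj₁ (next-loop (path zero) (path-unique zero))
    ; depth-root   = proj₂ (next-loop (path zero) (path-unique zero))
    ; depth-parent = λ {x} → next-length (path x) (path-unique x)
    }

  open Ancestors rooted

  adj-parent : ∀ {x} → x ≢ zero → Adj x (parent x)
  adj-parent {x} = next-adj (path x)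

  -- If `u` is on the path of `v`, acyclicity makes it the first step there. If not, stepping to `v`
  -- and following its path avoids returning to `u`, so the path of `u` also starts with `v`.
  adj⇒parent : ∀ {u v} → Adj u v → parent u ≡ v ⊎ parent v ≡ u
  adj⇒parent {u} {v} uv with u ∈? vs (path v)
  ... | yes u∈ = inj₂ (towards (path v) (path-unique v) u∈)
    where
    towards : ∀ {r} (p : Walk Adj v r) → Unique (vs p) → u ∈ vs p → next p ≡ u
    towards []      _  (here ≡.refl) = ⊥-elim (adj-irrefl uv)
    towards (_ ∷ _) _  (here ≡.refl) = ⊥-elim (adj-irrefl uv)
    towards (e ∷ p) pu (there u∈p) with prefix p u∈p
    ... | q , q⊆p = same-neighbour adj-sym acyclic e (adj-sym uv) q (λ v∈q → fresh pu (q⊆p v∈q))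
  ... | no u∉ = inj₁ (away (path u) (path-unique u))
    where
    away : (p : Walk Adj u zero) → Unique (vs p) → next p ≡ v
    away []      _  = ⊥-elim (u∉ (end-∈ (path v)))
    away (e ∷ p) pu = same-first-step adj-sym acyclic e uv p (path v) (fresh pu) u∉

  -- The root has no edge above it and receives a default.
  ω : V → Carrier
  ω x with x ≟ zero
  ... | yes _ = ε
  ... | no _  = w x (parent x)

  ω≈w : ∀ {x} → x ≢ zero → ω x ≈ w x (parent x)
  ω≈w {x} x≢0 with x ≟ zero
  ... | yes eq = ⊥-elim (x≢0 eq)
  ... | no _   = refl

  ω-nonneg : ∀ x → ε ≤ ω x
  ω-nonneg x with x ≟ zero
  ... | yes _  = ≤-refl
  ... | no x≢0 = proj₁ (w-pos (adj-parent x≢0))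

  ω-pos : ∀ {x} → x ≢ zero → ¬ (ω x ≤ ε)
  ω-pos {x} x≢0 le = proj₂ (w-pos (adj-parent x≢0))
    (antisym (proj₁ (w-pos (adj-parent x≢0))) (≤-trans (≤-reflexive (sym (ω≈w x≢0))) le))

  open TreeMetric G rooted ω ω-nonneg ω-pos

  d-parent : ∀ {x} → x ≢ zero → d x (parent x) ≈ w x (parent x)
  d-parent {x} x≢0 = trans (d-step x≢0 (⋣parent x≢0))
    (trans (∙-cong (ω≈w x≢0) (d-refl (parent x))) (identityʳ _))

  non-root : ∀ {x y} → Adj x y → parent x ≡ y → x ≢ zero
  non-root xy eq ≡.refl = adj-irrefl (subst (Adj zero) (≡.trans (≡.sym eq) parent-root) xy)

  d-adj : ∀ {u v} → Adj u v → d u v ≈ w u v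
  d-adj {u} {v} uv with adj⇒parent uv
  ... | inj₁ eq = subst (λ y → d u y ≈ w u y) eq (d-parent (non-root uv eq))
  ... | inj₂ eq = trans (d-sym u v) (trans (subst (λ y → d v y ≈ w v y) eq (d-parent (non-root (adj-sym uv) eq)))
                    (w-sym (adj-sym uv)))

  d≤weight : ∀ {u v} (p : Walk Adj u v) → d u v ≤ weight p
  d≤weight []      = ≤-reflexive (d-refl _)
  d≤weight (e ∷ p) = ≤-trans (d-triangle _ _ _) (∙-mono-≤ (≤-reflexive (d-adj e)) (d≤weight p))

  weight-++ʷ : ∀ {u v t} (p : Walk Adj u v) (q : Walk Adj v t) → weight (p ++ʷ q) ≈ weight p ∙ weight q
  weight-++ʷ []      q = sym (identityˡ _)
  weight-++ʷ (e ∷ p) q = trans (∙-congˡ (weight-++ʷ p q)) (sym (assoc _ _ _))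

  weight-reverseʷ : ∀ {u v} (p : Walk Adj u v) → weight (reverseʷ adj-sym p) ≈ weight p
  weight-reverseʷ []      = refl
  weight-reverseʷ (e ∷ p) = trans (weight-++ʷ (reverseʷ adj-sym p) _)
    (trans (∙-cong (weight-reverseʷ p) (trans (identityʳ _) (w-sym (adj-sym e)))) (comm _ _))

  ascent : ∀ {a x} → a ⊒ x → Σ (Walk Adj x a) λ p → weight p ≈ d x a
  ascent {a} here = [] , sym (d-refl a)
  ascent {a} (up {x} q) with x ≟ zero
  -- The root is its own parent, so this `up` does not move.
  ... | yes ≡.refl = subst (λ y → Σ (Walk Adj y a) λ p → weight p ≈ d y a) parent-root (ascent q)
  ... | no x≢0 with ascent q
  ...   | p , eq = adj-parent x≢0 ∷ p ,
    trans (∙-cong (sym (ω≈w x≢0)) eq) (sym (d-step x≢0 (λ x⊒a → ⋣parent x≢0 (⊒-trans x⊒a q))))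

  -- Climb from `u` to the lca and descend to `v`.
  geodesic : ∀ u v → Σ (Walk Adj u v) λ p → weight p ≈ d u v
  geodesic u v with ascent (lca⊒ˡ u v) | ascent (lca⊒ʳ u v)
  ... | p , p≈ | q , q≈ = p ++ʷ reverseʷ adj-sym q ,
    trans (weight-++ʷ p (reverseʷ adj-sym q)) (trans (∙-cong p≈ (trans (weight-reverseʷ q) (trans q≈ (d-sym v (lca u v)))))
      (sym (d-between (record { covers = lca-lowest u v ; within = λ w⊒a → inj₁ (⊒-trans w⊒a (lca⊒ˡ u v)) }))))

  -- `d` bounds every walk from below and is the weight of the geodesic, so it agrees with the
  -- shortest-path metric.
  d≈⇒≈d : ∀ {u v r} → (u d≈ v) r → d u v ≈ r
  d≈⇒≈d {u} {v} ((p , p≈r) , least) = antisym (≤-trans (d≤weight p) (≤-reflexive p≈r))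
    (≤-trans (least (proj₁ (geodesic u v))) (≤-reflexive (proj₂ (geodesic u v))))

  open Assembly ≡.refl public
    using (embedding; embedding-lipschitz; embedding-realises; embedding-prioritized)

  isometric : IsometricEmbedding T embedding
  isometric u v r duv = (λ t → upper t) , attained
    where
    d≈r = d≈⇒≈d duv
    upper : ∀ t → (embedding u t − embedding v t ≤ r) × (embedding v t − embedding u t ≤ r)
    upper t = ≤-trans (≤∙⇒−≤ (embedding-lipschitz t u v)) (≤-reflexive d≈r)
            , ≤-trans (≤∙⇒−≤ (embedding-lipschitz t v u)) (≤-reflexive (trans (d-sym v u) d≈r))
    attained : ∃ λ t → (embedding u t − embedding v t ≈ r) ⊎ (embedding v t − embedding u t ≈ r)
    attained with u ≟ v
    -- The distance is `ε` here, and any coordinate attains it.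
    ... | yes ≡.refl = 0 , inj₁ (trans (inverseʳ _) (trans (sym (d-refl u)) d≈r))
    ... | no u≢v with embedding-realises u≢v
    ...   | t , inj₁ eq = t , inj₂ (trans (≈∙⇒−≈ eq) d≈r)
    ...   | t , inj₂ eq = t , inj₁ (trans (≈∙⇒−≈ eq) d≈r)

theorem4p2 : (c ℓ₁ ℓ₂ : Level) →
    Σ ℕ λ C →
      ∀ (G : OrderedAbelianGroup c ℓ₁ ℓ₂) (n : ℕ) (T : WeightedTree G n) →
        Σ (Fin n → ℕ → OrderedAbelianGroup.Carrier G) λ f →
          IsometricEmbedding T f × HasPrioritizedDimension T (logBound C) f
theorem4p2 c ℓ₁ ℓ₂ = 32 , construct
  where
  construct : ∀ (G : OrderedAbelianGroup c ℓ₁ ℓ₂) (n : ℕ) (T : WeightedTree G n) →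
        Σ (Fin n → ℕ → OrderedAbelianGroup.Carrier G) λ f →
          IsometricEmbedding T f × HasPrioritizedDimension T (logBound 32) f
  -- Without vertices there is no root to choose, and all claims are empty.
  construct G zero    T = (λ ()) , (λ ()) , λ ()
  construct G (suc m) T = Rooting.embedding T , Rooting.isometric T , Rooting.embedding-prioritized T
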